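{- Let $m\ge1$ and $u,v\in\mathcal{W}(B_{2m+1})$ with $u<v$ in Bruhat order and $v^{ -1}(2m+1)<u^{ -1}(2m+1)$ (as integers in $[\pm(2m+1)]$). Then $u\leqslant c(v)$.
   Context: For $k\ge1$, $B_k$ is the group of bijections $w$ of $[\pm k]=\{ -k,\dots,-1,1,\dots,k\}$ with $w(-a)=-w(a)$; it is a Coxeter group with generators $(1,-1)$ and $(a,a+1)(-a,-a-1)$, $a\in[k-1]$; $\leqslant$ is Bruhat order. For $a\in[n]$ let $a^*=a-1$ if $a$ even, $a^*=a+1$ if $a$ odd and $a+1\le n$, $a^*=n$ otherwise; $\mathcal{W}(B_n)=\{v\in B_n: |v^{ -1}(a)-v^{ -1}(a^*)|\le1\ \forall a\in[n-1]\}$ (here $v^{ -1}(a)\in[\pm n]$). For $v\in\mathcal{W}(B_{2m+1})$ let $j:=v^{ -1}(2m+1)$ and define $c(v):=v\circ t\in\mathcal{W}(B_{2m+1})$ (composition of functions on $[\pm(2m+1)]$), where $t=(1,-1)$ if $j=-1$; $t=(j+1,j+2)(-j-1,-j-2)$ if $j\neq-1$ and $v(j+1)>v(j+2)$; and $t=(j,j+2)(-j,-j-2)$ if $j\neq-1$ and $v(j+1)<v(j+2)$. -}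

module Defs where

open import Data.Nat as ℕ using (ℕ; zero; suc; _≡ᵇ_; _≤ᵇ_; _%_; _∸_)
open import Data.Integer as ℤ using (ℤ; +_; -[1+_]; -_; ∣_∣)
open import Data.Integer.Properties using (_<?_)
import Data.Integer.Properties as ℤP
open import Data.Fin using (Fin; toℕ)
open import Data.Vec using (Vec; []; _∷_; map; tabulate; lookup)
open import Data.Bool using (if_then_else_)
open import Data.Product using (Σ; ∃; _×_; _,_)
open import Relation.Nullary using (does; ¬_)
open import Relation.Binary.PropositionalEquality using (_≡_)
open import Relation.Binary.Construct.Closure.ReflexiveTransitive using (Star)

-- An element w of B_n is stored in one-line notation: the vector
-- (w(1), ..., w(n)) of integers; w(-a) = -w(a) is implicit.
SPerm : ℕ → Set
SPerm n = Vec ℤ n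

Valid : (n : ℕ) → SPerm n → Set
Valid n w = (∀ (i : Fin n) → 1 ℕ.≤ ∣ lookup w i ∣ × ∣ lookup w i ∣ ℕ.≤ n)
          × (∀ (i j : Fin n) → ∣ lookup w i ∣ ≡ ∣ lookup w j ∣ → i ≡ j)

-- k-th entry (0-based), junk value 0 out of range
nth : ∀ {n} → Vec ℤ n → ℕ → ℤ
nth [] _ = + 0
nth (x ∷ xs) zero = x
nth (x ∷ xs) (suc k) = nth xs k

-- evaluation w(x) for x ∈ [±n]  (junk value 0 for x = 0 or |x| > n)
app : ∀ {n} → SPerm n → ℤ → ℤ
app w (+ zero) = + 0
app w (+ suc k) = nth w k
app w -[1+ k ] = - nth w k

compose : ∀ {n} → SPerm n → SPerm n → SPerm n
compose v w = map (app v) w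

idP : (n : ℕ) → SPerm n
idP n = tabulate (λ i → + suc (toℕ i))

swapZ : ℤ → ℤ → ℤ → ℤ
swapZ i j x =
  if does (x ℤP.≟ i) then j else
  if does (x ℤP.≟ - i) then - j else
  if does (x ℤP.≟ j) then i else
  if does (x ℤP.≟ - j) then - i else x

-- the element (i,j)(-i,-j) of B_n (for i = 1, j = -1 this is (1,-1))
transp : (n : ℕ) → ℤ → ℤ → SPerm n
transp n i j = map (swapZ i j) (idP n)

data Gen (n : ℕ) : SPerm n → Set where
  gen0 : Gen n (transp n (+ 1) (- (+ 1)))
  genA : (a : ℕ) → 1 ℕ.≤ a → a ℕ.< n → Gen n (transp n (+ a) (+ suc a))

data Word (n : ℕ) : SPerm n → ℕ → Set where
  nil  : Word n (idP n) 0
  snoc : ∀ {w s k} → Gen n s → Word n w k → Word n (compose w s) (suc k)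

Length : (n : ℕ) → SPerm n → ℕ → Set
Length n w k = Word n w k × (∀ k' → Word n w k' → k ℕ.≤ k')

-- reflections: conjugates w s w⁻¹ of generators (t w = w s)
IsReflection : (n : ℕ) → SPerm n → Set
IsReflection n t = ∃ λ w → Valid n w × ∃ λ s → Gen n s × compose t w ≡ compose w s

BStep : (n : ℕ) → SPerm n → SPerm n → Set
BStep n u w = ∃ λ t → IsReflection n t × w ≡ compose u t
  × ∃ λ k → ∃ λ k' → Length n u k × Length n w k' × k ℕ.< k'

BruhatLe : (n : ℕ) → SPerm n → SPerm n → Set
BruhatLe n = Star (BStep n)

BruhatLt : (n : ℕ) → SPerm n → SPerm n → Set
BruhatLt n u v = BruhatLe n u v × ¬ (u ≡ v)

-- w⁻¹(a) ∈ [±n]  (junk 0 if a is not a value)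
pos : ∀ {n} → SPerm n → ℤ → ℤ
pos w a = go w 1
  where
  go : ∀ {k} → Vec ℤ k → ℕ → ℤ
  go [] i = + 0
  go (x ∷ xs) i =
    if does (x ℤP.≟ a) then + i else
    if does (x ℤP.≟ - a) then - (+ i) else go xs (suc i)

star : ℕ → ℕ → ℕ
star n a = if (a % 2) ≡ᵇ 0 then a ∸ 1 else (if suc a ≤ᵇ n then suc a else n)

InW : (n : ℕ) → SPerm n → Set
InW n v = Valid n v ×
  (∀ a → 1 ℕ.≤ a → a ℕ.< n → ∣ pos v (+ a) ℤ.- pos v (+ star n a) ∣ ℕ.≤ 1)

cmap : (n : ℕ) → SPerm n → SPerm n
cmap n v = compose v t
  where
  j : ℤ
  j = pos v (+ n)
  t : SPerm n
  t = if does (j ℤP.≟ - (+ 1)) then transp n (+ 1) (- (+ 1)) else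
      (if does (app v (j ℤ.+ + 2) <? app v (j ℤ.+ + 1))
         then transp n (j ℤ.+ + 1) (j ℤ.+ + 2)
         else transp n j (j ℤ.+ + 2))

{-# OPTIONS --safe #-}
module Submission where

-- Bruhat order on B_n is the comparison of all numbers R w k c = #{b > k : w(b) ≤ c}.  Steps of the
-- order increase them by the exchange condition.  Conversely, if w has a descent at a, then right
-- multiplication by the a-th generator changes only row k = a, and at an ascent this row is the
-- smallest one compatible with its neighbours; so R u ≤ R w is inherited when descents are removed,
-- and a chain from u to w arises by induction on a word of w.
--
-- An element of W(B_n), n = 2m + 1, consists of adjacent pairs ±{2i-1, 2i} and the entry ±n.  Counting
-- a list of pairs gives an even number at each threshold c not separating partners, and the mean of
-- the two neighbouring values at the others.  In the rows where c(v) differs from v, removing ±n turns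
-- the counts of u and of v into such functions, shifted against each other by one.  Hence R u < R v
-- wherever R c(v) = R v - 1, and R u ≤ R c(v) follows.

open import Defs
open import Data.Bool using (Bool; true; false; not; if_then_else_)
open import Data.Empty using (⊥; ⊥-elim)
open import Data.Fin as Fin using (Fin; toℕ; fromℕ<; punchOut)
import Data.Fin.Properties as FP
open import Data.Integer using (ℤ; +_; -_; -[1+_]; ∣_∣; _⊖_)
import Data.Integer as ℤ
import Data.Integer.Properties as ℤP
open import Data.Nat using (ℕ; zero; suc; _≤_; _<_; _*_; _+_; z≤n; s≤s)
import Data.Nat as ℕ
import Data.Nat.DivMod as DM
open import Data.Nat.Induction using (<-wellFounded)
import Data.Nat.Properties as ℕP
open import Algebra.Properties.CommutativeSemigroup ℕP.+-commutativeSemigroup using (interchange)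
open import Data.Product using (∃; _×_; _,_; proj₁; proj₂)
open import Data.Sum using (_⊎_; inj₁; inj₂)
open import Data.Unit using (⊤; tt)
open import Data.Vec using (Vec; []; _∷_; map; tabulate; lookup)
open import Data.Vec.Properties using (map-cong; lookup-map; lookup∘tabulate)
open import Function using (_∘_)
open import Induction.WellFounded using (Acc; acc)
open import Relation.Binary.Construct.Closure.ReflexiveTransitive using (Star; ε; _◅_; _◅◅_; gmap)
open import Relation.Binary.Definitions using (Tri; tri<; tri≈; tri>)
open import Relation.Binary.PropositionalEquality
open import Relation.Nullary using (Dec; does; yes; no; ¬_; contradiction)
open import Relation.Nullary.Decidable using (dec-true; dec-false)

-- Signed transpositions and evaluation

-- The Bruhat part argues with words in the generators more than with permutations: a step asks for
-- lengths, exchange needs only a word, and a nontrivial chain from u to v supplies words for both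
-- ends. Equal values at two different positions are not excluded; they make the transposition act
-- trivially. The map c moves n past one pair or reorders the pair next to it: n, a, b becomes n, b,
-- a if a > b, and b, a, n if a < b. The mirrored moves bring -n to the front, where it turns into
-- n. Each move lowers a count by at most one, so a gain of one is all that has to be found. It
-- comes from parity: the entry n is invisible at thresholds below n, while dropping -n or one entry
-- of a pair costs at most one count, and two even numbers cannot satisfy f = g + 1.

record InR (n : ℕ) (x : ℤ) : Set where
  constructor inR
  field
    lower : 1 ≤ ∣ x ∣
    upper : ∣ x ∣ ≤ n

NZ : ℤ → Set
NZ x = x ≢ + 0

InR⇒NZ : ∀ {n x} → InR n x → NZ x
InR⇒NZ (inR () _) refl

NZ-neg : ∀ {x} → NZ x → NZ (- x)
NZ-neg {x} nz eq = nz (trans (sym (ℤP.neg-involutive x)) (cong -_ eq))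

InR-neg : ∀ {n x} → InR n x → InR n (- x)
InR-neg {n} {x} (inR p q) rewrite sym (ℤP.∣-i∣≡∣i∣ x) = inR p q

x≢-x : ∀ {x} → NZ x → x ≢ - x
x≢-x {+ zero} nz _ = nz refl
x≢-x {+ suc n} nz ()
x≢-x { -[1+ n ]} nz ()

neg-swap : ∀ {x y} → - x ≡ y → x ≡ - y
neg-swap {x} eq = trans (sym (ℤP.neg-involutive x)) (cong -_ eq)

-- The equations overlap when j = -i, the case of the generator (1,-1). Each of the first four
-- constructors records only the equation that selects it, and the lemmas below check that
-- overlapping branches agree.
data SwapView (i j x : ℤ) : ℤ → Set where
  at-i  : x ≡ i → SwapView i j x j
  at-ī : x ≡ - i → SwapView i j x (- j)
  at-j  : x ≡ j → SwapView i j x i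
  at-j̄ : x ≡ - j → SwapView i j x (- i)
  other : x ≢ i → x ≢ - i → x ≢ j → x ≢ - j → SwapView i j x x

swapView : ∀ i j x → SwapView i j x (swapZ i j x)
swapView i j x with x ℤP.≟ i | x ℤP.≟ - i | x ℤP.≟ j | x ℤP.≟ - j
... | yes p | _ | _ | _ = at-i p
... | no _ | yes p | _ | _ = at-ī p
... | no _ | no _ | yes p | _ = at-j p
... | no _ | no _ | no _ | yes p = at-j̄ p
... | no a | no b | no c | no d = other a b c d

swapZ-i : ∀ i j → swapZ i j i ≡ j
swapZ-i i j rewrite dec-true (i ℤP.≟ i) refl = refl

swapZ-ī : ∀ {i} j → NZ i → swapZ i j (- i) ≡ - j
swapZ-ī {i} j nz with swapZ i j (- i) | swapView i j (- i)
... | _ | at-i p = contradiction (sym p) (x≢-x nz)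
... | _ | at-ī p = refl
... | _ | at-j p = neg-swap (sym (sym p))
... | _ | at-j̄ p = p
... | _ | other _ p _ _ = contradiction refl p

swapZ-j : ∀ i {j} → NZ j → swapZ i j j ≡ i
swapZ-j i {j} nz with swapZ i j j | swapView i j j
... | _ | at-i p = p
... | _ | at-ī p = sym (neg-swap (sym p))
... | _ | at-j p = refl
... | _ | at-j̄ p = contradiction p (x≢-x nz)
... | _ | other _ _ p _ = contradiction refl p

swapZ-j̄ : ∀ i {j} → NZ j → swapZ i j (- j) ≡ - i
swapZ-j̄ i {j} nz with swapZ i j (- j) | swapView i j (- j)
... | _ | at-i p = neg-swap p
... | _ | at-ī p = p
... | _ | at-j p = contradiction (sym p) (x≢-x nz)
... | _ | at-j̄ p = refl
... | _ | other _ _ _ p = contradiction refl p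

swapZ-other : ∀ {i j x} → x ≢ i → x ≢ - i → x ≢ j → x ≢ - j → swapZ i j x ≡ x
swapZ-other {i} {j} {x} a b c d
  rewrite dec-false (x ℤP.≟ i) a | dec-false (x ℤP.≟ - i) b
        | dec-false (x ℤP.≟ j) c | dec-false (x ℤP.≟ - j) d = refl

-- Conjugation by an odd injective map moves the two points of a signed transposition. The predicate
-- `P` localises injectivity: `sw a` is injective everywhere, `app w` on [±n].
swapZ-conj : ∀ (f : ℤ → ℤ) (P : ℤ → Set) → (∀ z → f (- z) ≡ - f z) →
  (∀ {y z} → P y → P z → f y ≡ f z → y ≡ z) → (∀ {z} → P z → P (- z)) →
  ∀ {i j x} → NZ (f i) → NZ (f j) → P i → P j → P x → f (swapZ i j x) ≡ swapZ (f i) (f j) (f x)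
swapZ-conj f P odd inj pneg {i} {j} {x} nzi nzj pi pj px with swapZ i j x | swapView i j x
... | _ | at-i refl = sym (swapZ-i (f i) (f j))
... | _ | at-ī refl = trans (odd j) (sym (trans (cong (swapZ (f i) (f j)) (odd i)) (swapZ-ī (f j) nzi)))
... | _ | at-j refl = sym (swapZ-j (f i) nzj)
... | _ | at-j̄ refl = trans (odd i) (sym (trans (cong (swapZ (f i) (f j)) (odd j)) (swapZ-j̄ (f i) nzj)))
... | _ | other a b c d = sym (swapZ-other
        (a ∘ inj px pi) (λ e → b (inj px (pneg pi) (trans e (sym (odd i)))))
        (c ∘ inj px pj) (λ e → d (inj px (pneg pj) (trans e (sym (odd j))))))

swapZ-neg : ∀ {i j} → NZ i → NZ j → ∀ x → swapZ i j (- x) ≡ - swapZ i j x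
swapZ-neg {i} {j} nzi nzj x with swapZ i j x | swapView i j x
... | _ | at-i refl = swapZ-ī j nzi
... | _ | at-ī refl = trans (cong (swapZ i j) (ℤP.neg-involutive i)) (trans (swapZ-i i j) (sym (ℤP.neg-involutive j)))
... | _ | at-j refl = swapZ-j̄ i nzj
... | _ | at-j̄ refl = trans (cong (swapZ i j) (ℤP.neg-involutive j)) (trans (swapZ-j i nzj) (sym (ℤP.neg-involutive i)))
... | _ | other a b c d = swapZ-other (λ e → b (neg-swap e)) (a ∘ ℤP.neg-injective) (λ e → d (neg-swap e)) (c ∘ ℤP.neg-injective)

swapZ-involutive : ∀ {i j} → NZ i → NZ j → ∀ x → swapZ i j (swapZ i j x) ≡ x
swapZ-involutive {i} {j} nzi nzj x with swapZ i j x | swapView i j x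
... | _ | at-i refl = swapZ-j i nzj
... | _ | at-ī refl = swapZ-j̄ i nzj
... | _ | at-j refl = swapZ-i i j
... | _ | at-j̄ refl = swapZ-ī j nzi
... | _ | other a b c d = swapZ-other a b c d

swapZ-comm : ∀ {i j} → NZ i → NZ j → ∀ x → swapZ i j x ≡ swapZ j i x
swapZ-comm {i} {j} nzi nzj x with swapZ i j x | swapView i j x
... | _ | at-i refl = sym (swapZ-j j nzi)
... | _ | at-ī refl = sym (swapZ-j̄ j nzi)
... | _ | at-j refl = sym (swapZ-i j i)
... | _ | at-j̄ refl = sym (swapZ-ī i nzj)
... | _ | other a b c d = sym (swapZ-other c d a b)

swapZ-neg-neg : ∀ {i j} → NZ i → NZ j → ∀ x → swapZ (- i) (- j) x ≡ swapZ i j x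
swapZ-neg-neg {i} {j} nzi nzj x with swapZ i j x | swapView i j x
... | _ | at-i refl = trans (cong (swapZ (- i) (- j)) (sym (ℤP.neg-involutive i))) (trans (swapZ-ī (- j) (NZ-neg nzi)) (ℤP.neg-involutive j))
... | _ | at-ī refl = swapZ-i (- i) (- j)
... | _ | at-j refl = trans (cong (swapZ (- i) (- j)) (sym (ℤP.neg-involutive j))) (trans (swapZ-j̄ (- i) (NZ-neg nzj)) (ℤP.neg-involutive i))
... | _ | at-j̄ refl = swapZ-j (- i) (NZ-neg nzj)
... | _ | other a b c d = swapZ-other b (λ e → a (trans e (ℤP.neg-involutive i))) d (λ e → c (trans e (ℤP.neg-involutive j)))

swapZ-InR : ∀ {n i j x} → InR n i → InR n j → InR n x → InR n (swapZ i j x)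
swapZ-InR {n} {i} {j} {x} ri rj rx with swapZ i j x | swapView i j x
... | _ | at-i _ = rj
... | _ | at-ī _ = InR-neg rj
... | _ | at-j _ = ri
... | _ | at-j̄ _ = InR-neg ri
... | _ | other _ _ _ _ = rx

nth-out : ∀ {n} (w : SPerm n) k → n ≤ k → nth w k ≡ + 0
nth-out [] k _ = refl
nth-out (x ∷ w) (suc k) (s≤s n≤k) = nth-out w k n≤k

nth-map : ∀ {n} (f : ℤ → ℤ) → f (+ 0) ≡ + 0 → (w : SPerm n) → ∀ k → nth (map f w) k ≡ f (nth w k)
nth-map f f0 [] k = sym f0
nth-map f f0 (x ∷ w) zero = refl
nth-map f f0 (x ∷ w) (suc k) = nth-map f f0 w k

nth-tabulate : ∀ {n} (f : ℕ → ℤ) k → k < n → nth (tabulate {n = n} (f ∘ toℕ)) k ≡ f k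
nth-tabulate {suc n} f zero _ = refl
nth-tabulate {suc n} f (suc k) (s≤s k<n) = nth-tabulate (f ∘ suc) k k<n

nth-ext : ∀ {n} (v w : SPerm n) → (∀ k → nth v k ≡ nth w k) → v ≡ w
nth-ext [] [] h = refl
nth-ext (x ∷ v) (y ∷ w) h = cong₂ _∷_ (h 0) (nth-ext v w (h ∘ suc))

app-ext : ∀ {n} {v w : SPerm n} → (∀ x → app v x ≡ app w x) → v ≡ w
app-ext {v = v} {w} h = nth-ext v w (λ k → h (+ suc k))

app-out : ∀ {n} (w : SPerm n) x → n < ∣ x ∣ → app w x ≡ + 0
app-out w (+ suc k) (s≤s h) = nth-out w k h
app-out w -[1+ k ] (s≤s h) = cong -_ (nth-out w k h)

app-neg : ∀ {n} (w : SPerm n) x → app w (- x) ≡ - app w x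
app-neg w (+ zero) = refl
app-neg w (+ suc k) = refl
app-neg w -[1+ k ] = sym (ℤP.neg-involutive _)

app-compose : ∀ {n} (v w : SPerm n) x → app (compose v w) x ≡ app v (app w x)
app-compose v w (+ zero) = refl
app-compose v w (+ suc k) = nth-map (app v) refl w k
app-compose v w -[1+ k ] = trans (cong -_ (nth-map (app v) refl w k)) (sym (app-neg v (nth w k)))

compose-assoc : ∀ {n} (u v w : SPerm n) → compose (compose u v) w ≡ compose u (compose v w)
compose-assoc u v w = app-ext λ x → begin
  app (compose (compose u v) w) x  ≡⟨ app-compose (compose u v) w x ⟩
  app (compose u v) (app w x)      ≡⟨ app-compose u v (app w x) ⟩
  app u (app v (app w x))          ≡⟨ cong (app u) (app-compose v w x) ⟨
  app u (app (compose v w) x)      ≡⟨ app-compose u (compose v w) x ⟨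
  app (compose u (compose v w)) x  ∎
  where open ≡-Reasoning

app-idP : ∀ {n} x → ∣ x ∣ ≤ n → app (idP n) x ≡ x
app-idP (+ zero) _ = refl
app-idP (+ suc k) h = nth-tabulate (λ a → + suc a) k h
app-idP -[1+ k ] h = cong -_ (nth-tabulate (λ a → + suc a) k h)

app-transp : ∀ {n i j} → NZ i → NZ j → ∀ {x} → InR n x → app (transp n i j) x ≡ swapZ i j x
app-transp {n} {i} {j} nzi nzj {x} (inR l u) = go x l u
  where
  swap0 : swapZ i j (+ 0) ≡ + 0
  swap0 = swapZ-other (nzi ∘ sym) (NZ-neg nzi ∘ sym) (nzj ∘ sym) (NZ-neg nzj ∘ sym)
  nat : ∀ k → k < n → nth (transp n i j) k ≡ swapZ i j (+ suc k)
  nat k k<n = trans (nth-map (swapZ i j) swap0 (idP n) k) (cong (swapZ i j) (nth-tabulate (λ a → + suc a) k k<n))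
  go : ∀ x → 1 ≤ ∣ x ∣ → ∣ x ∣ ≤ n → app (transp n i j) x ≡ swapZ i j x
  go (+ suc k) _ k<n = nat k k<n
  go -[1+ k ] _ k<n = trans (cong -_ (nat k k<n)) (sym (swapZ-neg nzi nzj (+ suc k)))

-- Outside [±n] every app takes the junk value 0.
app-ext-InR : ∀ {n} {v w : SPerm n} → (∀ {x} → InR n x → app v x ≡ app w x) → v ≡ w
app-ext-InR {n} {v} {w} h = app-ext go
  where
  go : ∀ x → app v x ≡ app w x
  go (+ 0) = refl
  go x@(+ suc k) with k ℕP.<? n
  ... | yes k<n = h {x} (inR (s≤s z≤n) k<n)
  ... | no k≮n = trans (app-out v x (s≤s (ℕP.≮⇒≥ k≮n))) (sym (app-out w x (s≤s (ℕP.≮⇒≥ k≮n))))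
  go x@(-[1+ k ]) with k ℕP.<? n
  ... | yes k<n = h {x} (inR (s≤s z≤n) k<n)
  ... | no k≮n = trans (app-out v x (s≤s (ℕP.≮⇒≥ k≮n))) (sym (app-out w x (s≤s (ℕP.≮⇒≥ k≮n))))

-- At 0 and outside [±n] both sides are the junk value 0, because `swapZ` fixes such x when i and j
-- are in range. Later pointwise computations can therefore use it for every integer x.
app-act : ∀ {n i j} → InR n i → InR n j → (w : SPerm n) → ∀ x →
  app (compose w (transp n i j)) x ≡ app w (swapZ i j x)
app-act {n} {i} {j} ri rj w x = trans (app-compose w (transp n i j) x) go
  where
  nzi = InR⇒NZ ri
  nzj = InR⇒NZ rj
  away : ∣ x ∣ ≢ ∣ i ∣ → ∣ x ∣ ≢ ∣ j ∣ → swapZ i j x ≡ x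
  away xi xj = swapZ-other (xi ∘ cong ∣_∣) (λ e → xi (trans (cong ∣_∣ e) (ℤP.∣-i∣≡∣i∣ i)))
    (xj ∘ cong ∣_∣) (λ e → xj (trans (cong ∣_∣ e) (ℤP.∣-i∣≡∣i∣ j)))
  out : app (transp n i j) x ≡ + 0 → app w x ≡ + 0 → swapZ i j x ≡ x →
    app w (app (transp n i j) x) ≡ app w (swapZ i j x)
  out t0 w0 sx = trans (cong (app w) t0) (trans (sym w0) (cong (app w) (sym sx)))
  go : app w (app (transp n i j) x) ≡ app w (swapZ i j x)
  go with ∣ x ∣ ℕP.≤? n | 1 ℕP.≤? ∣ x ∣
  ... | yes u | yes l = cong (app w) (app-transp nzi nzj {x} (inR l u))
  ... | no ¬u | _ = out (app-out (transp n i j) x (ℕP.≰⇒> ¬u)) (app-out w x (ℕP.≰⇒> ¬u))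
    (away (λ e → ¬u (subst (_≤ n) (sym e) (InR.upper ri))) (λ e → ¬u (subst (_≤ n) (sym e) (InR.upper rj))))
  ... | yes _ | no ¬l = out (cong (app (transp n i j)) x0) (cong (app w) x0)
    (away (λ e → ¬l (subst (1 ≤_) (sym e) (InR.lower ri))) (λ e → ¬l (subst (1 ≤_) (sym e) (InR.lower rj))))
    where x0 = ℤP.∣i∣≡0⇒i≡0 {x} (ℕP.n<1⇒n≡0 (ℕP.≰⇒> ¬l))

act-ext : ∀ {n i j} → InR n i → InR n j → {v w : SPerm n} →
  (∀ x → app v x ≡ app w (swapZ i j x)) → v ≡ compose w (transp n i j)
act-ext ri rj {v} {w} h = app-ext λ x → trans (h x) (sym (app-act ri rj w x))

act-involutive : ∀ {n i j} → InR n i → InR n j → (w : SPerm n) →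
  compose (compose w (transp n i j)) (transp n i j) ≡ w
act-involutive {n} {i} {j} ri rj w = sym (act-ext ri rj λ x → sym (trans (app-act ri rj w (swapZ i j x))
  (cong (app w) (swapZ-involutive (InR⇒NZ ri) (InR⇒NZ rj) x))))

lo hi : ℕ → ℤ
lo zero = -[1+ 0 ]
lo (suc a) = + suc a
hi a = + suc a

-- The generators (1,-1) and (a,a+1)(-a,-a-1) all swap two neighbours lo a < hi a of [±n], with lo 0 = -1.
sw : ℕ → ℤ → ℤ
sw a = swapZ (lo a) (hi a)

σ : (n a : ℕ) → SPerm n
σ n a = transp n (lo a) (hi a)

lo-NZ : ∀ a → NZ (lo a)
lo-NZ zero ()
lo-NZ (suc a) ()

hi-NZ : ∀ a → NZ (hi a)
hi-NZ a ()

lo-InR : ∀ {n a} → a < n → InR n (lo a)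
lo-InR {a = zero} h = inR (s≤s z≤n) h
lo-InR {a = suc a} h = inR (s≤s z≤n) (ℕP.<⇒≤ h)

hi-InR : ∀ {n a} → a < n → InR n (hi a)
hi-InR h = inR (s≤s z≤n) h

lo<hi : ∀ a → lo a ℤ.< hi a
lo<hi zero = ℤ.-<+
lo<hi (suc a) = ℤ.+<+ ℕP.≤-refl

sw-involutive : ∀ a x → sw a (sw a x) ≡ x
sw-involutive a = swapZ-involutive (lo-NZ a) (hi-NZ a)

sw-injective : ∀ a {x y} → sw a x ≡ sw a y → x ≡ y
sw-injective a {x} {y} eq = trans (sym (sw-involutive a x)) (trans (cong (sw a) eq) (sw-involutive a y))

sw-NZ : ∀ a {x} → NZ x → NZ (sw a x)
sw-NZ a {x} nz eq = nz (sw-injective a {x} {+ 0} (trans eq (sym sw0)))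
  where sw0 : sw a (+ 0) ≡ + 0
        sw0 = swapZ-other (lo-NZ a ∘ sym) (NZ-neg (lo-NZ a) ∘ sym) (hi-NZ a ∘ sym) (NZ-neg (hi-NZ a) ∘ sym)

sw-InR : ∀ {n a x} → a < n → InR n x → InR n (sw a x)
sw-InR a<n = swapZ-InR (lo-InR a<n) (hi-InR a<n)

sw-conj : ∀ a {i j} → NZ i → NZ j → ∀ x → sw a (swapZ i j x) ≡ swapZ (sw a i) (sw a j) (sw a x)
sw-conj a {i} {j} nzi nzj x = swapZ-conj (sw a) (λ _ → ⊤) (swapZ-neg (lo-NZ a) (hi-NZ a))
  (λ _ _ → sw-injective a) (λ _ → tt) {i} {j} {x} (sw-NZ a nzi) (sw-NZ a nzj) tt tt tt

i<suc[i] : ∀ {i} → i ℤ.< ℤ.suc i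
i<suc[i] = ℤP.suc[i]≤j⇒i<j ℤP.≤-refl

j≡suc[i]⇒i<j : ∀ i {j} → j ≡ ℤ.suc i → i ℤ.< j
j≡suc[i]⇒i<j i refl = i<suc[i]

i<suc[j]⇒i≤j : ∀ {i j} → i ℤ.< ℤ.suc j → i ℤ.≤ j
i<suc[j]⇒i≤j {i} {j} h with ℤP.≤-total i j
... | inj₁ i≤j = i≤j
... | inj₂ j≤i with j ℤP.≟ i
... | yes refl = j≤i
... | no j≢i = contradiction h (ℤP.≤⇒≯ (ℤP.i<j⇒suc[i]≤j (ℤP.≤∧≢⇒< j≤i j≢i)))

-- For a > 0 the generator displaces an integer by at most one, so it can invert only two neighbours
-- that move towards each other.
data Move (a : ℕ) (x y : ℤ) : Set where
  up   : y ≡ ℤ.suc x → x ≡ lo a ⊎ x ≡ - hi a → Move a x y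
  down : x ≡ ℤ.suc y → x ≡ hi a ⊎ x ≡ - lo a → Move a x y
  fix  : y ≡ x → Move a x y

move : ∀ b x → Move (suc b) x (sw (suc b) x)
move b x with sw (suc b) x | swapView (lo (suc b)) (hi (suc b)) x
... | _ | at-i refl = up refl (inj₁ refl)
... | _ | at-ī refl = down refl (inj₂ refl)
... | _ | at-j refl = down refl (inj₁ refl)
... | _ | at-j̄ refl = up refl (inj₂ refl)
... | _ | other _ _ _ _ = fix refl

-- The exceptions are the two pairs of neighbours that the generator exchanges; they coincide for a
-- = 0. There -1 and 1 are neighbours in [±n] but not in ℤ, so 0 has to be excluded and `Move` is
-- replaced by inspection.
sw-order : ∀ a {i j} → NZ i → NZ j → i ℤ.< j →
  sw a i ℤ.< sw a j ⊎ (i ≡ lo a × j ≡ hi a) ⊎ (i ≡ - hi a × j ≡ - lo a)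
sw-order zero {+ 0} nzi nzj i<j = contradiction refl nzi
sw-order zero {i} {+ 0} nzi nzj i<j = contradiction refl nzj
sw-order zero {+ 1} {+ 1} nzi nzj (ℤ.+<+ (s≤s ()))
sw-order zero {+ 1} {+ suc (suc j)} nzi nzj i<j = inj₁ ℤ.-<+
sw-order zero {+ suc (suc i)} {+ 1} nzi nzj (ℤ.+<+ (s≤s ()))
sw-order zero {+ suc (suc i)} {+ suc (suc j)} nzi nzj i<j = inj₁ i<j
sw-order zero { -[1+ 0 ]} {+ 1} nzi nzj i<j = inj₂ (inj₁ (refl , refl))
sw-order zero { -[1+ 0 ]} {+ suc (suc j)} nzi nzj i<j = inj₁ (ℤ.+<+ (s≤s (s≤s z≤n)))
sw-order zero { -[1+ suc i ]} {+ 1} nzi nzj i<j = inj₁ (ℤ.-<- (s≤s z≤n))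
sw-order zero { -[1+ suc i ]} {+ suc (suc j)} nzi nzj i<j = inj₁ ℤ.-<+
sw-order zero { -[1+ 0 ]} { -[1+ j ]} nzi nzj (ℤ.-<- ())
sw-order zero { -[1+ suc i ]} { -[1+ 0 ]} nzi nzj i<j = inj₁ ℤ.-<+
sw-order zero { -[1+ suc i ]} { -[1+ suc j ]} nzi nzj i<j = inj₁ i<j
sw-order (suc b) {i} {j} nzi nzj i<j with ℤP.<-cmp (sw (suc b) i) (sw (suc b) j)
... | tri< lt _ _ = inj₁ lt
... | tri≈ _ eq _ = contradiction (sw-injective (suc b) eq) (ℤP.<⇒≢ i<j)
... | tri> _ _ gt = inj₂ (go (move b i) (move b j) gt)
  where
  go : ∀ {y z} → Move (suc b) i y → Move (suc b) j z → z ℤ.< y →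
    (i ≡ lo (suc b) × j ≡ hi (suc b)) ⊎ (i ≡ - hi (suc b) × j ≡ - lo (suc b))
  ¬low : ∀ {y z} → y ℤ.≤ i → Move (suc b) j z → z ℤ.< y → ⊥
  ¬low y≤i (up refl _) z<y = ℤP.<-asym i<j (ℤP.<-trans (i<suc[i] {j}) (ℤP.<-≤-trans z<y y≤i))
  ¬low {y} {z} y≤i (down refl _) z<y = ℤP.<⇒≱ z<y (ℤP.≤-trans y≤i (i<suc[j]⇒i≤j i<j))
  ¬low y≤i (fix refl) z<y = ℤP.<-asym i<j (ℤP.<-≤-trans z<y y≤i)
  go (up refl _) (up refl _) z<y = ⊥-elim (ℤP.<⇒≱ z<y (ℤP.≤-trans (ℤP.i<j⇒suc[i]≤j i<j) (ℤP.i≤suc[i] _)))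
  go (up refl _) (fix refl) z<y = ⊥-elim (ℤP.<⇒≱ z<y (ℤP.i<j⇒suc[i]≤j i<j))
  go (up _ (inj₁ refl)) (down _ (inj₁ refl)) z<y = inj₁ (refl , refl)
  go (up _ (inj₂ refl)) (down _ (inj₂ refl)) z<y = inj₂ (refl , refl)
  go (up _ (inj₁ refl)) (down _ (inj₂ refl)) z<y = ⊥-elim (ℤP.<⇒≱ i<j ℤ.-≤+)
  go {z = + _} (up refl (inj₂ refl)) (down e (inj₁ refl)) ()
  go {z = -[1+ zero ]} (up refl (inj₂ refl)) (down () (inj₁ refl)) z<y
  go {z = -[1+ suc _ ]} (up refl (inj₂ refl)) (down () (inj₁ refl)) z<y
  go (down refl _) m z<y = ⊥-elim (¬low (ℤP.i≤suc[i] _) m z<y)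
  go (fix refl) m z<y = ⊥-elim (¬low ℤP.≤-refl m z<y)

-- Words and lengths

transp-cong : ∀ {n i j i' j'} → (∀ x → swapZ i j x ≡ swapZ i' j' x) → transp n i j ≡ transp n i' j'
transp-cong {n} h = map-cong h (idP n)

transp-comm : ∀ {n i j} → NZ i → NZ j → transp n i j ≡ transp n j i
transp-comm nzi nzj = transp-cong (swapZ-comm nzi nzj)

transp-flip : ∀ {n i j} → NZ i → NZ j → transp n (- j) (- i) ≡ transp n i j
transp-flip {i = i} {j} nzi nzj = transp-cong λ x → trans (swapZ-neg-neg nzj nzi x) (swapZ-comm nzj nzi x)

σ-Gen : ∀ {n a} → a < n → Gen n (σ n a)
σ-Gen {n} {zero} h = subst (Gen n) (transp-comm (λ ()) (λ ())) gen0
σ-Gen {n} {suc a} h = genA (suc a) (s≤s z≤n) h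

Gen⇒σ : ∀ {n s} → 1 ≤ n → Gen n s → ∃ λ a → a < n × s ≡ σ n a
Gen⇒σ 1≤n gen0 = 0 , 1≤n , transp-comm (λ ()) (λ ())
Gen⇒σ 1≤n (genA (suc a) _ h) = suc a , h , refl

act-equal : ∀ {n i j} → InR n i → InR n j → (w : SPerm n) → app w i ≡ app w j → compose w (transp n i j) ≡ w
act-equal {n} {i} {j} ri rj w eq = app-ext λ x → trans (app-act ri rj w x) (go x)
  where
  eq⁻ : app w (- i) ≡ app w (- j)
  eq⁻ = trans (app-neg w i) (trans (cong -_ eq) (sym (app-neg w j)))
  go : ∀ x → app w (swapZ i j x) ≡ app w x
  go x with swapZ i j x | swapView i j x
  ... | _ | at-i refl = sym eq
  ... | _ | at-ī refl = sym eq⁻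
  ... | _ | at-j refl = eq
  ... | _ | at-j̄ refl = eq⁻
  ... | _ | other _ _ _ _ = refl

-- This is w (s t s) s = w s t: it carries a transposition past the last letter of a word or past a
-- generator multiplied onto a chain.
σ-conj : ∀ {n a i j} → a < n → InR n i → InR n j → (w : SPerm n) →
  compose (compose w (transp n (sw a i) (sw a j))) (σ n a) ≡ compose (compose w (σ n a)) (transp n i j)
σ-conj {n} {a} {i} {j} a<n ri rj w = app-ext λ x → begin
  app (compose (compose w T) (σ n a)) x        ≡⟨ app-act lr hr (compose w T) x ⟩
  app (compose w T) (sw a x)                   ≡⟨ app-act (sw-InR a<n ri) (sw-InR a<n rj) w (sw a x) ⟩
  app w (swapZ (sw a i) (sw a j) (sw a x))     ≡⟨ cong (app w) (sw-conj a (InR⇒NZ ri) (InR⇒NZ rj) x) ⟨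
  app w (sw a (swapZ i j x))                   ≡⟨ app-act lr hr w (swapZ i j x) ⟨
  app (compose w (σ n a)) (swapZ i j x)        ≡⟨ app-act ri rj (compose w (σ n a)) x ⟨
  app (compose (compose w (σ n a)) (transp n i j)) x  ∎
  where
  open ≡-Reasoning
  T = transp n (sw a i) (sw a j)
  lr = lo-InR a<n
  hr = hi-InR a<n

-- The strong exchange condition: the deleted letter is the one whose reflection
-- inverts the pair of positions reached from (i , j) by the letters after it.
exchange : ∀ {n w k i j} → Word n w k → InR n i → InR n j → i ℤ.< j → app w j ℤ.< app w i →
  ∃ λ k' → k' < k × Word n (compose w (transp n i j)) k'
exchange {n} {i = i} {j} nil ri rj i<j wj<wi = ⊥-elim (ℤP.<-asym i<j
  (subst₂ ℤ._<_ (app-idP j (InR.upper rj)) (app-idP i (InR.upper ri)) wj<wi))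
exchange {n} {i = i} {j} (snoc {w} g W) ri rj i<j wj<wi
  with Gen⇒σ (ℕP.≤-trans (InR.lower ri) (InR.upper ri)) g
... | a , a<n , refl with sw-order a (InR⇒NZ ri) (InR⇒NZ rj) i<j
... | inj₁ si<sj with exchange W (sw-InR a<n ri) (sw-InR a<n rj) si<sj
        (subst₂ ℤ._<_ (app-act (lo-InR a<n) (hi-InR a<n) w j) (app-act (lo-InR a<n) (hi-InR a<n) w i) wj<wi)
...   | k' , k'<k , W' = suc k' , s≤s k'<k , subst (λ z → Word n z (suc k')) (σ-conj a<n ri rj w) (snoc (σ-Gen a<n) W')
exchange {n} (snoc {w} {k = k} g W) ri rj i<j wj<wi | a , a<n , refl | inj₂ (inj₁ (refl , refl)) =
  k , ℕP.≤-refl , subst (λ z → Word n z k) (sym (act-involutive ri rj w)) W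
exchange {n} (snoc {w} {k = k} g W) ri rj i<j wj<wi | a , a<n , refl | inj₂ (inj₂ (refl , refl)) =
  k , ℕP.≤-refl , subst (λ z → Word n z k)
    (sym (trans (cong (compose (compose w (σ n a))) (transp-flip (lo-NZ a) (hi-NZ a))) (act-involutive (lo-InR a<n) (hi-InR a<n) w))) W

Descent Ascent : ∀ {n} → SPerm n → ℕ → Set
Descent w a = app w (hi a) ℤ.< app w (lo a)
Ascent w a = app w (lo a) ℤ.≤ app w (hi a)

app-σ-lo : ∀ {n a} → a < n → (w : SPerm n) → app (compose w (σ n a)) (lo a) ≡ app w (hi a)
app-σ-lo {a = a} a<n w = trans (app-act (lo-InR a<n) (hi-InR a<n) w (lo a)) (cong (app w) (swapZ-i (lo a) (hi a)))

app-σ-hi : ∀ {n a} → a < n → (w : SPerm n) → app (compose w (σ n a)) (hi a) ≡ app w (lo a)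
app-σ-hi {a = a} a<n w = trans (app-act (lo-InR a<n) (hi-InR a<n) w (hi a)) (cong (app w) (swapZ-j (lo a) (hi-NZ a)))

exchange-σ : ∀ {n w k a} → a < n → Word n w k → Descent w a → ∃ λ k' → k' < k × Word n (compose w (σ n a)) k'
exchange-σ {a = a} a<n W d = exchange W (lo-InR a<n) (hi-InR a<n) (lo<hi a) d

descent? : ∀ {n} (w : SPerm n) → (∃ λ a → a < n × Descent w a) ⊎ (∀ a → a < n → Ascent w a)
descent? {n} w with ℕP.anyUpTo? (λ a → app w (hi a) ℤP.<? app w (lo a)) n
... | yes d = inj₁ d
... | no ¬d = inj₂ λ a a<n → ℤP.≮⇒≥ λ d → ¬d (a , a<n , d)

-- If the prefix before the last letter descends there, exchange yields a shorter word. Otherwise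
-- prefix and product both ascend weakly there, so the two values agree and the last letter acts
-- trivially.
ascending⇒id : ∀ {n w k} → 1 ≤ n → Word n w k → (∀ a → a < n → Ascent w a) → w ≡ idP n
ascending⇒id {n} 1≤n W asc = go (<-wellFounded _) W asc
  where
  go : ∀ {w k} → Acc _<_ k → Word n w k → (∀ a → a < n → Ascent w a) → w ≡ idP n
  go _ nil asc = refl
  go (acc rec) (snoc {w} g W) asc with Gen⇒σ 1≤n g
  ... | a , a<n , refl with app w (hi a) ℤP.<? app w (lo a)
  ...   | yes d = let k' , k'<k , W' = exchange-σ a<n W d in go (rec (ℕP.m<n⇒m<1+n k'<k)) W' asc
  ...   | no ¬d = trans ws≡w (go (rec ℕP.≤-refl) W (subst (λ z → ∀ a → a < n → Ascent z a) ws≡w asc))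
    where
    ws≡w : compose w (σ n a) ≡ w
    ws≡w = act-equal (lo-InR a<n) (hi-InR a<n) w (ℤP.≤-antisym (ℤP.≮⇒≥ ¬d)
      (subst₂ ℤ._≤_ (app-σ-lo a<n w) (app-σ-hi a<n w) (asc a a<n)))

-- At a descent, exchange turns every word of w into a shorter word of w s. A minimal word of w s
-- followed by s is therefore minimal for w, and no search through words is required.
Word⇒Length : ∀ {n w k} → 1 ≤ n → Word n w k → ∃ λ l → Length n w l
Word⇒Length {n} 1≤n W = go (<-wellFounded _) W
  where
  go : ∀ {w k} → Acc _<_ k → Word n w k → ∃ λ l → Length n w l
  go {w} (acc rec) W with descent? w
  ... | inj₂ asc = 0 , subst (λ z → Word n z 0) (sym (ascending⇒id 1≤n W asc)) nil , λ _ _ → z≤n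
  ... | inj₁ (a , a<n , d) with exchange-σ a<n W d
  ...   | k' , k'<k , W' with go (rec k'<k) W'
  ...     | l , V , minl = suc l
          , subst (λ z → Word n z (suc l)) (act-involutive (lo-InR a<n) (hi-InR a<n) w) (snoc (σ-Gen a<n) V)
          , λ k U → let k″ , k″<k , U' = exchange-σ a<n U d in ℕP.≤-<-trans (minl k″ U') k″<k

-- Reflections

∣∣-cases : ∀ x y → ∣ x ∣ ≡ ∣ y ∣ → x ≡ y ⊎ x ≡ - y
∣∣-cases (+ m) (+ n) refl = inj₁ refl
∣∣-cases (+ m) -[1+ n ] refl = inj₂ refl
∣∣-cases -[1+ m ] (+ n) refl = inj₂ refl
∣∣-cases -[1+ m ] -[1+ n ] refl = inj₁ refl

lookup-nth : ∀ {n} (w : SPerm n) i → lookup w i ≡ nth w (toℕ i)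
lookup-nth (x ∷ w) Fin.zero = refl
lookup-nth (x ∷ w) (Fin.suc i) = lookup-nth w i

nth-lookup : ∀ {n} (w : SPerm n) {k} (k<n : k < n) → nth w k ≡ lookup w (fromℕ< k<n)
nth-lookup w k<n = trans (cong (nth w) (sym (FP.toℕ-fromℕ< k<n))) (sym (lookup-nth w (fromℕ< k<n)))

nth-InR : ∀ {n} {w : SPerm n} → Valid n w → ∀ {k} → k < n → InR n (nth w k)
nth-InR {n} {w} (rng , _) k<n = subst (InR n) (sym (nth-lookup w k<n)) (inR (proj₁ (rng (fromℕ< k<n))) (proj₂ (rng (fromℕ< k<n))))

nth-∣∣-injective : ∀ {n} {w : SPerm n} → Valid n w → ∀ {k l} → k < n → l < n → ∣ nth w k ∣ ≡ ∣ nth w l ∣ → k ≡ l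
nth-∣∣-injective {n} {w} (_ , inj) {k} {l} k<n l<n eq = begin
  k                  ≡⟨ FP.toℕ-fromℕ< k<n ⟨
  toℕ (fromℕ< k<n)   ≡⟨ cong toℕ (inj (fromℕ< k<n) (fromℕ< l<n) (subst₂ (λ x y → ∣ x ∣ ≡ ∣ y ∣) (nth-lookup w k<n) (nth-lookup w l<n) eq)) ⟩
  toℕ (fromℕ< l<n)   ≡⟨ FP.toℕ-fromℕ< l<n ⟩
  l                  ∎
  where open ≡-Reasoning

app-InR : ∀ {n} {w : SPerm n} → Valid n w → ∀ {x} → InR n x → InR n (app w x)
app-InR V {+ 0} (inR () _)
app-InR {w = w} V {+ suc k} (inR _ u) = nth-InR {w = w} V u
app-InR {w = w} V { -[1+ k ]} (inR _ u) = InR-neg (nth-InR {w = w} V u)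

app-injective : ∀ {n} {w : SPerm n} → Valid n w → ∀ {x y} → InR n x → InR n y → app w x ≡ app w y → x ≡ y
app-injective {n} {w} V {x} {y} rx ry eq with ∣∣-cases x y (abs x y rx ry (cong ∣_∣ eq))
  where
  ∣app∣ : ∀ x → InR n x → ∃ λ k → ∣ x ∣ ≡ suc k × k < n × ∣ app w x ∣ ≡ ∣ nth w k ∣
  ∣app∣ (+ 0) (inR () _)
  ∣app∣ (+ suc k) (inR _ u) = k , refl , u , refl
  ∣app∣ -[1+ k ] (inR _ u) = k , refl , u , ℤP.∣-i∣≡∣i∣ (nth w k)
  abs : ∀ x y → InR n x → InR n y → ∣ app w x ∣ ≡ ∣ app w y ∣ → ∣ x ∣ ≡ ∣ y ∣
  abs x y rx ry e with ∣app∣ x rx | ∣app∣ y ry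
  ... | k , p , k<n , q | l , p' , l<n , q' = trans p (trans (cong suc (nth-∣∣-injective {w = w} V k<n l<n (trans (sym q) (trans e q')))) (sym p'))
... | inj₁ x≡y = x≡y
... | inj₂ refl = ⊥-elim (x≢-x (InR⇒NZ (app-InR {w = w} V ry)) (sym (trans (sym (app-neg w y)) eq)))

-- Pigeonhole: if a were missed, the absolute values would inject Fin (suc n) into Fin n.
nth-surjective : ∀ {n} {w : SPerm n} → Valid n w → ∀ {a} → 1 ≤ a → a ≤ n → ∃ λ k → k < n × ∣ nth w k ∣ ≡ a
nth-surjective {suc n} {w} V@(rng , inj) {suc a} _ a<n with FP.any? (λ i → ∣ lookup w i ∣ ℕP.≟ suc a)
... | yes (i , eq) = toℕ i , FP.toℕ<n i , trans (cong ∣_∣ (sym (lookup-nth w i))) eq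
... | no ¬hit = ⊥-elim (FP.<⇒notInjective {f = g} ℕP.≤-refl g-inj)
  where
  pred< : ∀ {m} → 1 ≤ m → m ≤ suc n → ℕ.pred m < suc n
  pred< (s≤s z≤n) h = h
  unpred : ∀ {m} → 1 ≤ m → suc (ℕ.pred m) ≡ m
  unpred (s≤s _) = refl
  f : Fin (suc n) → Fin (suc n)
  f i = fromℕ< (pred< (proj₁ (rng i)) (proj₂ (rng i)))
  toℕ-f : ∀ i → suc (toℕ (f i)) ≡ ∣ lookup w i ∣
  toℕ-f i = trans (cong suc (FP.toℕ-fromℕ< _)) (unpred (proj₁ (rng i)))
  miss : ∀ i → fromℕ< a<n ≢ f i
  miss i e = ¬hit (i , trans (sym (toℕ-f i)) (cong suc (trans (cong toℕ (sym e)) (FP.toℕ-fromℕ< a<n))))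
  g : Fin (suc n) → Fin n
  g i = punchOut (miss i)
  g-inj : ∀ {i j} → g i ≡ g j → i ≡ j
  g-inj {i} {j} e = inj i j (trans (sym (toℕ-f i)) (trans (cong (suc ∘ toℕ) (FP.punchOut-injective (miss i) (miss j) e)) (toℕ-f j)))

app-surjective : ∀ {n} {w : SPerm n} → Valid n w → ∀ {y} → InR n y → ∃ λ x → InR n x × app w x ≡ y
app-surjective {n} {w} V {y} (inR l u) with nth-surjective {w = w} V l u
... | k , k<n , eq with ∣∣-cases (nth w k) y eq
... | inj₁ e = + suc k , inR (s≤s z≤n) k<n , e
... | inj₂ e = -[1+ k ] , inR (s≤s z≤n) k<n , sym (neg-swap (sym e))

compose-idˡ : ∀ {n} {v : SPerm n} → (∀ {x} → InR n x → InR n (app v x)) → compose (idP n) v ≡ v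
compose-idˡ {n} {v} h = app-ext-InR λ {x} rx → trans (app-compose (idP n) v x) (app-idP (app v x) (InR.upper (h rx)))

compose-idʳ : ∀ {n} {v : SPerm n} → compose v (idP n) ≡ v
compose-idʳ {n} {v} = app-ext-InR λ {x} rx → trans (app-compose v (idP n) x) (cong (app v) (app-idP x (InR.upper rx)))

transp-idˡ : ∀ {n i j} → InR n i → InR n j → compose (idP n) (transp n i j) ≡ transp n i j
transp-idˡ {n} ri rj = compose-idˡ λ rx → subst (InR n) (sym (app-transp (InR⇒NZ ri) (InR⇒NZ rj) rx)) (swapZ-InR ri rj rx)

σ-idˡ : ∀ {n a} → a < n → compose (idP n) (σ n a) ≡ σ n a
σ-idˡ a<n = transp-idˡ (lo-InR a<n) (hi-InR a<n)

Valid-idP : ∀ n → Valid n (idP n)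
Valid-idP n = (λ i → subst (λ x → 1 ≤ ∣ x ∣ × ∣ x ∣ ≤ n) (sym (lookup∘tabulate _ i)) (s≤s z≤n , FP.toℕ<n i))
  , λ i j e → FP.toℕ-injective (ℕP.suc-injective (subst₂ (λ x y → ∣ x ∣ ≡ ∣ y ∣) (lookup∘tabulate _ i) (lookup∘tabulate _ j) e))

Valid-σ-compose : ∀ {n a} {w : SPerm n} → a < n → Valid n w → Valid n (compose (σ n a) w)
Valid-σ-compose {n} {a} {w} a<n V@(rng , inj) =
  (λ i → let r = subst (InR n) (sym (entry i)) (sw-InR a<n (rw i)) in InR.lower r , InR.upper r)
  , λ i j e → inj i j (sw-∣∣ {lookup w i} {lookup w j} (subst₂ (λ x y → ∣ x ∣ ≡ ∣ y ∣) (entry i) (entry j) e))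
  where
  rw : ∀ i → InR n (lookup w i)
  rw i = inR (proj₁ (rng i)) (proj₂ (rng i))
  entry : ∀ i → lookup (compose (σ n a) w) i ≡ sw a (lookup w i)
  entry i = trans (lookup-map i (app (σ n a)) w) (app-transp (lo-NZ a) (hi-NZ a) (rw i))
  sw-∣∣ : ∀ {x y} → ∣ sw a x ∣ ≡ ∣ sw a y ∣ → ∣ x ∣ ≡ ∣ y ∣
  sw-∣∣ {x} {y} e with ∣∣-cases (sw a x) (sw a y) e
  ... | inj₁ p = cong ∣_∣ (sw-injective a {x} {y} p)
  ... | inj₂ p = trans (cong ∣_∣ (sw-injective a {x} { - y} (trans p (sym (swapZ-neg (lo-NZ a) (hi-NZ a) y))))) (ℤP.∣-i∣≡∣i∣ y)

σ-reflection : ∀ {n a} → a < n → IsReflection n (σ n a)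
σ-reflection {n} {a} a<n = idP n , Valid-idP n , σ n a , σ-Gen a<n , trans compose-idʳ (sym (σ-idˡ a<n))

-- If w conjugates a generator into t, then s w conjugates the same generator into s t s.
reflection-conj : ∀ {n a i j} → a < n → InR n i → InR n j →
  IsReflection n (transp n i j) → IsReflection n (transp n (sw a i) (sw a j))
reflection-conj {n} {a} {i} {j} a<n ri rj (w , V , s , g , eq) =
  compose (σ n a) w , Valid-σ-compose {w = w} a<n V , s , g , (begin
  compose T' (compose (σ n a) w)   ≡⟨ compose-assoc T' (σ n a) w ⟨
  compose (compose T' (σ n a)) w   ≡⟨ cong (λ z → compose z w) T'σ≡σT ⟩
  compose (compose (σ n a) T) w    ≡⟨ compose-assoc (σ n a) T w ⟩
  compose (σ n a) (compose T w)    ≡⟨ cong (compose (σ n a)) eq ⟩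
  compose (σ n a) (compose w s)    ≡⟨ compose-assoc (σ n a) w s ⟨
  compose (compose (σ n a) w) s    ∎)
  where
  open ≡-Reasoning
  T = transp n i j
  T' = transp n (sw a i) (sw a j)
  T'σ≡σT : compose T' (σ n a) ≡ compose (σ n a) T
  T'σ≡σT = begin
    compose T' (σ n a)                       ≡⟨ cong (λ z → compose z (σ n a)) (transp-idˡ (sw-InR a<n ri) (sw-InR a<n rj)) ⟨
    compose (compose (idP n) T') (σ n a)     ≡⟨ σ-conj a<n ri rj (idP n) ⟩
    compose (compose (idP n) (σ n a)) T      ≡⟨ cong (λ z → compose z T) (σ-idˡ a<n) ⟩
    compose (σ n a) T                        ∎

-- The equation t w = w s determines t on the values of w, which exhaust [±n]; there t exchanges the
-- images of the two points of s.
reflection⇒transp : ∀ {n t} → 1 ≤ n → IsReflection n t →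
  ∃ λ i → ∃ λ j → InR n i × InR n j × i ℤ.< j × t ≡ transp n i j
reflection⇒transp {n} {t} 1≤n (w , V , s , g , eq) with Gen⇒σ 1≤n g
... | a , a<n , refl = order (ℤP.<-cmp (app w (lo a)) (app w (hi a)))
  where
  ri = app-InR {w = w} V (lo-InR a<n)
  rj = app-InR {w = w} V (hi-InR a<n)
  t≡ : t ≡ transp n (app w (lo a)) (app w (hi a))
  t≡ = app-ext-InR λ ry → go ry (app-surjective {w = w} V ry)
    where
    open ≡-Reasoning
    go : ∀ {y} → InR n y → (∃ λ x → InR n x × app w x ≡ y) → app t y ≡ app (transp n (app w (lo a)) (app w (hi a))) y
    go ry (x , rx , refl) = begin
      app t (app w x)               ≡⟨ app-compose t w x ⟨
      app (compose t w) x           ≡⟨ cong (λ z → app z x) eq ⟩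
      app (compose w (σ n a)) x     ≡⟨ app-act (lo-InR a<n) (hi-InR a<n) w x ⟩
      app w (sw a x)                ≡⟨ swapZ-conj (app w) (InR n) (app-neg w) (app-injective {w = w} V) InR-neg
                                         (InR⇒NZ ri) (InR⇒NZ rj) (lo-InR a<n) (hi-InR a<n) rx ⟩
      swapZ (app w (lo a)) (app w (hi a)) (app w x) ≡⟨ app-transp (InR⇒NZ ri) (InR⇒NZ rj) ry ⟨
      app (transp n (app w (lo a)) (app w (hi a))) (app w x) ∎
  order : Tri _ _ _ → _
  order (tri< lt _ _) = _ , _ , ri , rj , lt , t≡
  order (tri≈ _ e _) = contradiction (app-injective {w = w} V (lo-InR a<n) (hi-InR a<n) e) (ℤP.<⇒≢ (lo<hi a))
  order (tri> _ _ gt) = _ , _ , rj , ri , gt , trans t≡ (transp-comm (InR⇒NZ ri) (InR⇒NZ rj))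

-- Upward steps and their lifting by a generator

HasWord : (n : ℕ) → SPerm n → Set
HasWord n w = ∃ λ k → Word n w k

HasWord-σ : ∀ {n a w} → a < n → HasWord n w → HasWord n (compose w (σ n a))
HasWord-σ a<n (k , W) = suc k , snoc (σ-Gen a<n) W

-- A Bruhat step whose length inequality is replaced by the order of two values, a condition that
-- passes easily through a generator. The words at both ends are kept so that the lengths can be
-- recovered.
record Up (n : ℕ) (x z : SPerm n) : Set where
  field
    {i j} : ℤ
    ri : InR n i
    rj : InR n j
    i<j : i ℤ.< j
    xi<xj : app x i ℤ.< app x j
    refln : IsReflection n (transp n i j)
    z≡ : z ≡ compose x (transp n i j)
    word-x : HasWord n x
    word-z : HasWord n z

-- Were the pair already inverted in u, exchange would give w a word shorter than the length of u,
-- hence shorter than its own length.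
BStep-inverts : ∀ {n u w} → 1 ≤ n → BStep n u w →
  w ≡ u ⊎ (∃ λ i → ∃ λ j → InR n i × InR n j × i ℤ.< j × app u i ℤ.< app u j × w ≡ compose u (transp n i j))
BStep-inverts {n} {u} 1≤n (t , refl-t , refl , k , k' , (U , _) , (_ , min') , k<k') with reflection⇒transp 1≤n refl-t
... | i , j , ri , rj , i<j , refl with ℤP.<-cmp (app u i) (app u j)
... | tri< lt _ _ = inj₂ (i , j , ri , rj , i<j , lt , refl)
... | tri≈ _ e _ = inj₁ (act-equal ri rj u e)
... | tri> _ _ gt = let k″ , k″<k , W = exchange U ri rj i<j gt in
  ⊥-elim (ℕP.<-irrefl refl (ℕP.<-≤-trans (ℕP.<-trans k″<k k<k') (min' k″ W)))

-- The pair is inverted in z, so exchange shortens a minimal word of z to a word of x.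
Up⇒BStep : ∀ {n x z} → 1 ≤ n → Up n x z → BStep n x z
Up⇒BStep {n} {x} 1≤n record
  { i = i ; j = j ; ri = ri ; rj = rj ; i<j = i<j ; xi<xj = xi<xj
  ; refln = r ; z≡ = refl ; word-x = wx ; word-z = wz }
  with Word⇒Length 1≤n (proj₂ wx) | Word⇒Length 1≤n (proj₂ wz)
... | k , Lx@(_ , minx) | k' , Lz@(Z , _) with exchange Z ri rj i<j zj<zi
  where
  zj<zi : app (compose x (transp n i j)) j ℤ.< app (compose x (transp n i j)) i
  zj<zi = subst₂ ℤ._<_
    (sym (trans (app-act ri rj x j) (cong (app x) (swapZ-j i (InR⇒NZ rj)))))
    (sym (trans (app-act ri rj x i) (cong (app x) (swapZ-i i j)))) xi<xj
... | k″ , k″<k' , X = transp n i j , r , refl , k , k' , Lx , Lz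
  , ℕP.≤-<-trans (minx k″ (subst (λ y → Word n y k″) (act-involutive ri rj x) X)) k″<k'

Up-σ : ∀ {n a y} → a < n → HasWord n y → app y (lo a) ℤ.< app y (hi a) → Up n y (compose y (σ n a))
Up-σ {a = a} a<n wy lt = record
  { ri = lo-InR a<n ; rj = hi-InR a<n ; i<j = lo<hi a ; xi<xj = lt
  ; refln = σ-reflection a<n ; z≡ = refl ; word-x = wy ; word-z = HasWord-σ a<n wy }

-- Multiplying a chain by σ reverses a step only if that step is multiplication by σ itself.
Up-lift : ∀ {n a x y} → a < n → HasWord n y → app y (lo a) ℤ.< app y (hi a) →
  Star (Up n) x y → Star (Up n) (compose x (σ n a)) (compose y (σ n a))
Up-lift a<n wy lt ε = ε
Up-lift {n} {a} {x} {y} a<n wy lt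
  (record
    { i = i ; j = j ; ri = ri ; rj = rj ; i<j = i<j ; xi<xj = xi<xj
    ; refln = refln ; z≡ = refl ; word-x = wx ; word-z = wz } ◅ chain)
  with sw-order a (InR⇒NZ ri) (InR⇒NZ rj) i<j
... | inj₁ si<sj = lifted ◅ Up-lift a<n wy lt chain
  where
  app-xσ : ∀ k → app (compose x (σ n a)) (sw a k) ≡ app x k
  app-xσ k = trans (app-act (lo-InR a<n) (hi-InR a<n) x (sw a k)) (cong (app x) (sw-involutive a k))
  lifted : Up n (compose x (σ n a)) (compose (compose x (transp n i j)) (σ n a))
  lifted = record
    { ri = sw-InR a<n ri ; rj = sw-InR a<n rj ; i<j = si<sj
    ; xi<xj = subst₂ ℤ._<_ (sym (app-xσ i)) (sym (app-xσ j)) xi<xj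
    ; refln = reflection-conj a<n ri rj refln
    ; z≡ = trans (cong₂ (λ p q → compose (compose x (transp n p q)) (σ n a)) (sym (sw-involutive a i)) (sym (sw-involutive a j)))
        (σ-conj a<n (sw-InR a<n ri) (sw-InR a<n rj) x)
    ; word-x = HasWord-σ a<n wx ; word-z = HasWord-σ a<n wz }
-- The step leads from x to x σ, so the rest of the chain already starts at the right element; it
-- stays unlifted and is extended from y to y σ.
... | inj₂ (inj₁ (refl , refl)) = chain ◅◅ (Up-σ a<n wy lt ◅ ε)
... | inj₂ (inj₂ (refl , refl)) =
  subst (λ z → Star (Up n) z y) (cong (compose x) (transp-flip (lo-NZ a) (hi-NZ a))) chain ◅◅ (Up-σ a<n wy lt ◅ ε)

-- Counting entries and Bruhat order

ind : ℤ → ℤ → ℕ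
ind c x = if does (x ℤP.≤? c) then 1 else 0

ind-≤ : ∀ {c x} → x ℤ.≤ c → ind c x ≡ 1
ind-≤ {c} {x} h rewrite dec-true (x ℤP.≤? c) h = refl

ind-> : ∀ {c x} → c ℤ.< x → ind c x ≡ 0
ind-> {c} {x} h rewrite dec-false (x ℤP.≤? c) (ℤP.<⇒≱ h) = refl

ind≤1 : ∀ c x → ind c x ≤ 1
ind≤1 c x with x ℤP.≤? c
... | yes _ = ℕP.≤-refl
... | no _ = z≤n

ind-antitone : ∀ c {x y} → x ℤ.≤ y → ind c y ≤ ind c x
ind-antitone c {x} {y} x≤y with y ℤP.≤? c
... | no _ = z≤n
... | yes y≤c = ℕP.≤-reflexive (sym (ind-≤ (ℤP.≤-trans x≤y y≤c)))

Sum : ∀ {n} → (ℤ → ℕ) → Vec ℤ n → ℕ → ℕ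
Sum h [] k = 0
Sum h (x ∷ w) zero = h x ℕ.+ Sum h w zero
Sum h (x ∷ w) (suc k) = Sum h w k

Sum-step : ∀ {n} h (w : Vec ℤ n) {k} → k < n → Sum h w k ≡ h (nth w k) ℕ.+ Sum h w (suc k)
Sum-step h (x ∷ w) {zero} _ = refl
Sum-step h (x ∷ w) {suc k} (s≤s k<n) = Sum-step h w k<n

Sum-out : ∀ {n} h (w : Vec ℤ n) {k} → n ≤ k → Sum h w k ≡ 0
Sum-out h [] _ = refl
Sum-out h (x ∷ w) {suc k} (s≤s n≤k) = Sum-out h w n≤k

downward : ∀ {ℓ n} (P : ℕ → Set ℓ) → (∀ k → n ≤ k → P k) → (∀ k → k < n → P (suc k) → P k) → ∀ k → P k
downward {n = n} P out step k = go (n ℕ.∸ k) k (ℕP.m≤n+m∸n n k)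
  where
  go : ∀ d k → n ≤ k ℕ.+ d → P k
  go zero k h = out k (subst (n ≤_) (ℕP.+-identityʳ k) h)
  go (suc d) k h with k ℕP.<? n
  ... | yes k<n = step k k<n (go d (suc k) (subst (n ≤_) (ℕP.+-suc k d) h))
  ... | no k≮n = out k (ℕP.≮⇒≥ k≮n)

Sum-mono : ∀ {n} {h h' : ℤ → ℕ} (w w' : Vec ℤ n) k →
  (∀ l → k ≤ l → h (nth w l) ≤ h' (nth w' l)) → Sum h w k ≤ Sum h' w' k
Sum-mono {n} {h} {h'} w w' = downward (λ k → (∀ l → k ≤ l → h (nth w l) ≤ h' (nth w' l)) → Sum h w k ≤ Sum h' w' k)
  (λ k out _ → ℕP.≤-trans (ℕP.≤-reflexive (Sum-out h w out)) z≤n)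
  (λ k k<n ih le → subst₂ _≤_ (sym (Sum-step h w k<n)) (sym (Sum-step h' w' k<n))
    (ℕP.+-mono-≤ (le k ℕP.≤-refl) (ih (λ l k<l → le l (ℕP.<⇒≤ k<l)))))

Sum-cong : ∀ {n} {h h' : ℤ → ℕ} (w w' : Vec ℤ n) k →
  (∀ l → k ≤ l → h (nth w l) ≡ h' (nth w' l)) → Sum h w k ≡ Sum h' w' k
Sum-cong w w' k e = ℕP.≤-antisym (Sum-mono w w' k (λ l p → ℕP.≤-reflexive (e l p)))
  (Sum-mono w' w k (λ l p → ℕP.≤-reflexive (sym (e l p))))

Sum-+ : ∀ {n} {h f g : ℤ → ℕ} → (∀ x → h x ≡ f x ℕ.+ g x) → (w : Vec ℤ n) → ∀ k → Sum h w k ≡ Sum f w k ℕ.+ Sum g w k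
Sum-+ e [] k = refl
Sum-+ {h = h} {f} {g} e (x ∷ w) zero = trans (cong₂ ℕ._+_ (e x) (Sum-+ e w zero)) (interchange (f x) (g x) _ _)
Sum-+ e (x ∷ w) (suc k) = Sum-+ e w k

record Swapped {n} (w w' : SPerm n) (p q : ℕ) : Set where
  field
    p<q : p < q
    q<n : q < n
    at-p : nth w' p ≡ nth w q
    at-q : nth w' q ≡ nth w p
    elsewhere : ∀ l → l ≢ p → l ≢ q → nth w' l ≡ nth w l

module _ {n} {w w' : SPerm n} {p q} (S : Swapped w w' p q) (h : ℤ → ℕ) where
  open Swapped S

  Sum-swap-above : ∀ {k} → q < k → Sum h w' k ≡ Sum h w k
  Sum-swap-above {k} q<k = Sum-cong w' w k λ l k≤l → let q<l = ℕP.<-≤-trans q<k k≤l in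
    cong h (elsewhere l (ℕP.>⇒≢ (ℕP.<-trans p<q q<l)) (ℕP.>⇒≢ q<l))

  -- Such a tail contains position q but not p, so it trades the entry at q for the one at p. Sums
  -- on both sides avoid truncated subtraction.
  Sum-swap-between : ∀ k → p < k → k ≤ q → Sum h w' k ℕ.+ h (nth w q) ≡ Sum h w k ℕ.+ h (nth w p)
  Sum-swap-between = downward (λ k → p < k → k ≤ q → Sum h w' k ℕ.+ h (nth w q) ≡ Sum h w k ℕ.+ h (nth w p))
    (λ k n≤k _ k≤q → ⊥-elim (ℕP.<⇒≱ q<n (ℕP.≤-trans n≤k k≤q))) step
    where
    open ≡-Reasoning
    rot : ∀ a b c → a ℕ.+ b ℕ.+ c ≡ c ℕ.+ b ℕ.+ a
    rot a b c = trans (ℕP.+-comm (a ℕ.+ b) c) (trans (cong (c ℕ.+_) (ℕP.+-comm a b)) (sym (ℕP.+-assoc c b a)))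
    step : ∀ k → k < n → (p < suc k → suc k ≤ q → Sum h w' (suc k) ℕ.+ h (nth w q) ≡ Sum h w (suc k) ℕ.+ h (nth w p)) →
      p < k → k ≤ q → Sum h w' k ℕ.+ h (nth w q) ≡ Sum h w k ℕ.+ h (nth w p)
    step k k<n ih p<k k≤q with k ℕP.≟ q
    ... | yes refl = begin
      Sum h w' q ℕ.+ h (nth w q)                          ≡⟨ cong (ℕ._+ h (nth w q)) (Sum-step h w' k<n) ⟩
      h (nth w' q) ℕ.+ Sum h w' (suc q) ℕ.+ h (nth w q)   ≡⟨ cong₂ (λ a b → a ℕ.+ b ℕ.+ h (nth w q)) (cong h at-q) (Sum-swap-above ℕP.≤-refl) ⟩
      h (nth w p) ℕ.+ Sum h w (suc q) ℕ.+ h (nth w q)     ≡⟨ rot (h (nth w p)) _ _ ⟩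
      h (nth w q) ℕ.+ Sum h w (suc q) ℕ.+ h (nth w p)     ≡⟨ cong (ℕ._+ h (nth w p)) (Sum-step h w k<n) ⟨
      Sum h w q ℕ.+ h (nth w p)                           ∎
    ... | no k≢q = begin
      Sum h w' k ℕ.+ h (nth w q)                          ≡⟨ cong (ℕ._+ h (nth w q)) (Sum-step h w' k<n) ⟩
      h (nth w' k) ℕ.+ Sum h w' (suc k) ℕ.+ h (nth w q)   ≡⟨ cong (λ a → h a ℕ.+ Sum h w' (suc k) ℕ.+ h (nth w q)) (elsewhere k (ℕP.>⇒≢ p<k) k≢q) ⟩
      h (nth w k) ℕ.+ Sum h w' (suc k) ℕ.+ h (nth w q)    ≡⟨ ℕP.+-assoc (h (nth w k)) _ _ ⟩
      h (nth w k) ℕ.+ (Sum h w' (suc k) ℕ.+ h (nth w q))  ≡⟨ cong (h (nth w k) ℕ.+_) (ih (ℕP.m<n⇒m<1+n p<k) (ℕP.≤∧≢⇒< k≤q k≢q)) ⟩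
      h (nth w k) ℕ.+ (Sum h w (suc k) ℕ.+ h (nth w p))   ≡⟨ ℕP.+-assoc (h (nth w k)) _ _ ⟨
      h (nth w k) ℕ.+ Sum h w (suc k) ℕ.+ h (nth w p)     ≡⟨ cong (ℕ._+ h (nth w p)) (Sum-step h w k<n) ⟨
      Sum h w k ℕ.+ h (nth w p)                           ∎

  Sum-swap-below : ∀ k → k ≤ p → Sum h w' k ≡ Sum h w k
  Sum-swap-below = downward (λ k → k ≤ p → Sum h w' k ≡ Sum h w k)
    (λ k n≤k k≤p → ⊥-elim (ℕP.<⇒≱ (ℕP.<-trans p<q q<n) (ℕP.≤-trans n≤k k≤p))) step
    where
    open ≡-Reasoning
    step : ∀ k → k < n → (suc k ≤ p → Sum h w' (suc k) ≡ Sum h w (suc k)) → k ≤ p → Sum h w' k ≡ Sum h w k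
    step k k<n ih k≤p with k ℕP.≟ p
    ... | yes refl = begin
      Sum h w' p                            ≡⟨ Sum-step h w' k<n ⟩
      h (nth w' p) ℕ.+ Sum h w' (suc p)     ≡⟨ cong (λ a → h a ℕ.+ Sum h w' (suc p)) at-p ⟩
      h (nth w q) ℕ.+ Sum h w' (suc p)      ≡⟨ ℕP.+-comm (h (nth w q)) _ ⟩
      Sum h w' (suc p) ℕ.+ h (nth w q)      ≡⟨ Sum-swap-between (suc p) ℕP.≤-refl p<q ⟩
      Sum h w (suc p) ℕ.+ h (nth w p)       ≡⟨ ℕP.+-comm _ (h (nth w p)) ⟩
      h (nth w p) ℕ.+ Sum h w (suc p)       ≡⟨ Sum-step h w k<n ⟨
      Sum h w p                             ∎
    ... | no k≢p = begin
      Sum h w' k                            ≡⟨ Sum-step h w' k<n ⟩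
      h (nth w' k) ℕ.+ Sum h w' (suc k)     ≡⟨ cong₂ ℕ._+_ (cong h (elsewhere k k≢p (ℕP.<⇒≢ (ℕP.≤-<-trans k≤p p<q)))) (ih (ℕP.≤∧≢⇒< k≤p k≢p)) ⟩
      h (nth w k) ℕ.+ Sum h w (suc k)       ≡⟨ Sum-step h w k<n ⟨
      Sum h w k                             ∎

act-Swapped : ∀ {n} (w : SPerm n) {p q} → p < q → q < n → Swapped w (compose w (transp n (+ suc p) (+ suc q))) p q
act-Swapped {n} w {p} {q} p<q q<n = record
  { p<q = p<q ; q<n = q<n
  ; at-p = trans (value p) (cong (app w) (swapZ-i (+ suc p) (+ suc q)))
  ; at-q = trans (value q) (cong (app w) (swapZ-j (+ suc p) {+ suc q} (λ ())))
  ; elsewhere = λ l l≢p l≢q → trans (value l) (cong (app w) (swapZ-other {+ suc p} {+ suc q} {+ suc l}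
      (l≢p ∘ ℕP.suc-injective ∘ ℤP.+-injective) (λ ()) (l≢q ∘ ℕP.suc-injective ∘ ℤP.+-injective) (λ ()))) }
  where
  value : ∀ l → nth (compose w (transp n (+ suc p) (+ suc q))) l ≡ app w (swapZ (+ suc p) (+ suc q) (+ suc l))
  value l = app-act (inR (s≤s z≤n) (ℕP.<-trans p<q q<n)) (inR (s≤s z≤n) q<n) w (+ suc l)

-- Positions are 1-based in B_n and 0-based in nth: R w k c counts the b > k with w(b) ≤ c.
R : ∀ {n} → SPerm n → ℕ → ℤ → ℕ
R w k c = Sum (ind c) w k

infix 4 _⊑_
_⊑_ : ∀ {n} → SPerm n → SPerm n → Set
u ⊑ v = ∀ k c → R u k c ≤ R v k c

R-suc≤ : ∀ {n} (w : SPerm n) k c → R w (suc k) c ≤ R w k c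
R-suc≤ {n} w k c with k ℕP.<? n
... | yes k<n = subst (R w (suc k) c ≤_) (sym (Sum-step (ind c) w k<n)) (ℕP.m≤n+m _ _)
... | no k≮n = ℕP.≤-trans (ℕP.≤-reflexive (Sum-out (ind c) w (ℕP.m≤n⇒m≤1+n (ℕP.≮⇒≥ k≮n)))) z≤n

R≤suc : ∀ {n} (w : SPerm n) {k} → k < n → ∀ c → R w k c ≤ suc (R w (suc k) c)
R≤suc w {k} k<n c = subst (_≤ suc (R w (suc k) c)) (sym (Sum-step (ind c) w k<n)) (ℕP.+-monoˡ-≤ (R w (suc k) c) (ind≤1 c (nth w k)))

R-counted : ∀ {n} (w : SPerm n) {k c} → k < n → nth w k ℤ.≤ c → R w k c ≡ suc (R w (suc k) c)
R-counted w {k} {c} k<n le = trans (Sum-step (ind c) w k<n) (cong (ℕ._+ R w (suc k) c) (ind-≤ le))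

R-uncounted : ∀ {n} (w : SPerm n) {k c} → k < n → c ℤ.< nth w k → R w k c ≡ R w (suc k) c
R-uncounted w {k} {c} k<n lt = trans (Sum-step (ind c) w k<n) (cong (ℕ._+ R w (suc k) c) (ind-> lt))

swap-⊑ : ∀ {n} {w w' : SPerm n} {p q} → Swapped w w' p q → nth w p ℤ.< nth w q → w ⊑ w'
swap-⊑ {n} {w} {w'} {p} {q} S lt k c with k ℕP.≤? p | k ℕP.≤? q
... | yes k≤p | _ = ℕP.≤-reflexive (sym (Sum-swap-below S (ind c) k k≤p))
... | no _ | no k≰q = ℕP.≤-reflexive (sym (Sum-swap-above S (ind c) (ℕP.≰⇒> k≰q)))
... | no k≰p | yes k≤q = ℕP.+-cancelʳ-≤ (ind c (nth w q)) _ _ (ℕP.≤-trans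
  (ℕP.+-monoʳ-≤ (R w k c) (ind-antitone c (ℤP.<⇒≤ lt)))
  (ℕP.≤-reflexive (sym (Sum-swap-between S (ind c) k (ℕP.≰⇒> k≰p) k≤q))))

-- For positions of equal sign the smaller entry moves to the later place. For opposite signs every
-- affected entry becomes smaller, so no tail loses a count.
act-⊑ : ∀ {n i j} → InR n i → InR n j → i ℤ.< j → (w : SPerm n) → app w i ℤ.< app w j → w ⊑ compose w (transp n i j)
act-⊑ {n} {+ 0} (inR () _) rj i<j w lt
act-⊑ {n} {_} {+ 0} ri (inR () _) i<j w lt
act-⊑ {n} {+ suc p} {+ suc q} ri rj (ℤ.+<+ (s≤s p<q)) w lt = swap-⊑ (act-Swapped w p<q (InR.upper rj)) lt
act-⊑ {n} { -[1+ q ]} { -[1+ p ]} ri rj (ℤ.-<- p<q) w lt =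
  subst (λ t → w ⊑ compose w t) (transp-flip { i = -[1+ q ]} { -[1+ p ]} (λ ()) (λ ()))
    (swap-⊑ (act-Swapped w p<q (InR.upper ri)) (ℤP.neg-cancel-< lt))
act-⊑ {n} { -[1+ p ]} {+ suc q} ri rj i<j w lt k c = Sum-mono w (compose w (transp n -[1+ p ] (+ suc q))) k λ l _ → ind-antitone c (lower l)
  where
  lower : ∀ l → nth (compose w (transp n -[1+ p ] (+ suc q))) l ℤ.≤ nth w l
  lower l = ℤP.≤-trans (ℤP.≤-reflexive (app-act ri rj w (+ suc l))) (go l)
    where
    go : ∀ l → app w (swapZ -[1+ p ] (+ suc q) (+ suc l)) ℤ.≤ nth w l
    go l with swapZ -[1+ p ] (+ suc q) (+ suc l) | swapView -[1+ p ] (+ suc q) (+ suc l)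
    ... | _ | at-ī refl = ℤP.≤-trans (ℤP.<⇒≤ (ℤP.neg-mono-< lt)) (ℤP.≤-reflexive (ℤP.neg-involutive (nth w p)))
    ... | _ | at-j refl = ℤP.<⇒≤ lt
    ... | _ | other _ _ _ _ = ℤP.≤-refl

-- Comparison of counts and the Bruhat order

Bruhat⇒⊑ : ∀ {n u w} → 1 ≤ n → BruhatLe n u w → u ⊑ w
Bruhat⇒⊑ 1≤n ε k c = ℕP.≤-refl
Bruhat⇒⊑ {u = u} {w} 1≤n (s ◅ chain) with BStep-inverts 1≤n s
... | inj₁ refl = Bruhat⇒⊑ 1≤n chain
... | inj₂ (i , j , ri , rj , i<j , lt , refl) = λ k c → ℕP.≤-trans (act-⊑ ri rj i<j u lt k c) (Bruhat⇒⊑ 1≤n chain k c)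

σ-Swapped : ∀ {n b} → suc b < n → (w : SPerm n) → Swapped w (compose w (σ n (suc b))) b (suc b)
σ-Swapped b<n w = act-Swapped w ℕP.≤-refl b<n

Sum-σ : ∀ {n a} h → a < n → (w : SPerm n) → ∀ k → k ≢ a → Sum h (compose w (σ n a)) k ≡ Sum h w k
Sum-σ {a = zero} h a<n w zero k≢a = contradiction refl k≢a
Sum-σ {n} {zero} h a<n w (suc k) k≢a = Sum-cong (compose w (σ n 0)) w (suc k)
  λ { (suc l) _ → cong h (app-act (lo-InR a<n) (hi-InR a<n) w (+ suc (suc l))) }
Sum-σ {a = suc b} h a<n w k k≢a with ℕP.<-cmp k (suc b)
... | tri< (s≤s k≤b) _ _ = Sum-swap-below (σ-Swapped a<n w) h k k≤b
... | tri≈ _ e _ = contradiction e k≢a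
... | tri> _ _ gt = Sum-swap-above (σ-Swapped a<n w) h gt

absInd : ℕ → ℤ → ℕ
absInd m x = if does (∣ x ∣ ℕP.≤? m) then 1 else 0

ind-split : ∀ m x → ind (+ m) x ≡ ind -[1+ m ] x ℕ.+ absInd m x
ind-split m (+ k) = refl
ind-split m -[1+ k ] = sym (split (suc k ℕP.≤? m))
  where
  split : Dec (suc k ≤ m) → ind -[1+ m ] -[1+ k ] ℕ.+ absInd m -[1+ k ] ≡ 1
  split (yes k<m) = cong₂ ℕ._+_ (ind-> { -[1+ m ]} (ℤ.-<- k<m)) (cong (if_then 1 else 0) (dec-true (suc k ℕP.≤? m) k<m))
  split (no k≮m) = cong₂ ℕ._+_ (ind-≤ { -[1+ m ]} (ℤ.-≤- (ℕP.≮⇒≥ k≮m))) (cong (if_then 1 else 0) (dec-false (suc k ℕP.≤? m) k≮m))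

R-split : ∀ {n} (w : SPerm n) k m → R w k (+ m) ≡ R w k -[1+ m ] ℕ.+ Sum (absInd m) w k
R-split w k m = Sum-+ (ind-split m) w k

-- Generators permute the entries and change signs, which preserves the multiset of absolute values.
-- With `R-split`, row 0 at m is thereby determined by row 0 at the mirrored threshold -m-1.
absCount-const : ∀ {n w k} → 1 ≤ n → Word n w k → ∀ m → Sum (absInd m) w 0 ≡ Sum (absInd m) (idP n) 0
absCount-const 1≤n nil m = refl
absCount-const {n} 1≤n (snoc {w} g W) m with Gen⇒σ 1≤n g
... | suc b , a<n , refl = trans (Sum-swap-below (σ-Swapped a<n w) (absInd m) 0 z≤n) (absCount-const 1≤n W m)
... | zero , a<n , refl = trans (Sum-cong (compose w (σ n 0)) w 0 λ l _ → cong (λ a → if does (a ℕP.≤? m) then 1 else 0) (same l))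
        (absCount-const 1≤n W m)
  where
  same : ∀ l → ∣ nth (compose w (σ n 0)) l ∣ ≡ ∣ nth w l ∣
  same zero = trans (cong ∣_∣ (app-σ-hi a<n w)) (ℤP.∣-i∣≡∣i∣ (nth w 0))
  same (suc l) = cong ∣_∣ (app-act (lo-InR a<n) (hi-InR a<n) w (+ suc (suc l)))

-- At an ascent, row a is the least one compatible with its neighbours: for a > 0 these are rows
-- a - 1 and a + 1, and for a = 0 they are row 1 and its mirror image under w(-x) = - w(x).
ascent-⊑ : ∀ {n a} {x y : SPerm n} → a < n → HasWord n x → HasWord n y → Ascent x a →
  (∀ k → k ≢ a → ∀ c → R x k c ≤ R y k c) → x ⊑ y
ascent-⊑ {n} {a} {x} {y} a<n hx hy asc le k c with k ℕP.≟ a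
... | no k≢a = le k k≢a c
ascent-⊑ {n} {suc b} {x} {y} a<n hx hy asc le k c | yes refl with nth x (suc b) ℤP.≤? c
... | yes x≤c = ℕP.≤-pred (ℕP.≤-trans (ℕP.≤-reflexive (sym (R-counted x (ℕP.<⇒≤ a<n) (ℤP.≤-trans asc x≤c))))
      (ℕP.≤-trans (le b (ℕP.<⇒≢ ℕP.≤-refl) c) (R≤suc y (ℕP.<⇒≤ a<n) c)))
... | no x≰c = ℕP.≤-trans (ℕP.≤-reflexive (R-uncounted x a<n (ℤP.≰⇒> x≰c)))
      (ℕP.≤-trans (le (suc (suc b)) (ℕP.>⇒≢ ℕP.≤-refl) c) (R-suc≤ y (suc b) c))
ascent-⊑ {n} {zero} {x} {y} a<n hx hy asc le k c | yes refl with nth x 0 ℤP.≤? c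
... | no x≰c = ℕP.≤-trans (ℕP.≤-reflexive (R-uncounted x a<n (ℤP.≰⇒> x≰c)))
      (ℕP.≤-trans (le 1 (λ ()) c) (R-suc≤ y 0 c))
... | yes x≤c = mirror c x≤c
  where
  0≤x : + 0 ℤ.≤ nth x 0
  0≤x = nonneg (nth x 0) asc
    where
    nonneg : ∀ z → - z ℤ.≤ z → + 0 ℤ.≤ z
    nonneg (+ z) _ = ℤ.+≤+ z≤n
  mirror : ∀ c → nth x 0 ℤ.≤ c → R x 0 c ≤ R y 0 c
  mirror -[1+ m ] x≤c = contradiction (ℤP.≤-trans 0≤x x≤c) λ ()
  mirror (+ m) x≤c = begin
    R x 0 (+ m)                                  ≡⟨ R-split x 0 m ⟩
    R x 0 -[1+ m ] ℕ.+ Sum (absInd m) x 0        ≡⟨ cong₂ ℕ._+_ (R-uncounted x a<n (ℤP.<-≤-trans ℤ.-<+ 0≤x)) (absCount-const a<n (proj₂ hx) m) ⟩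
    R x 1 -[1+ m ] ℕ.+ Sum (absInd m) (idP n) 0  ≤⟨ ℕP.+-monoˡ-≤ _ (ℕP.≤-trans (le 1 (λ ()) -[1+ m ]) (R-suc≤ y 0 -[1+ m ])) ⟩
    R y 0 -[1+ m ] ℕ.+ Sum (absInd m) (idP n) 0  ≡⟨ cong (R y 0 -[1+ m ] ℕ.+_) (absCount-const a<n (proj₂ hy) m) ⟨
    R y 0 -[1+ m ] ℕ.+ Sum (absInd m) y 0        ≡⟨ R-split y 0 m ⟨
    R y 0 (+ m)                                  ∎
    where open ℕP.≤-Reasoning

-- This and `⊑-σ` are the two halves of the lifting property, for counts in place of the Bruhat
-- order.
σ-⊑ : ∀ {n a} {u w : SPerm n} → a < n → HasWord n u → HasWord n w → Ascent (compose u (σ n a)) a →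
  u ⊑ w → compose u (σ n a) ⊑ w
σ-⊑ {u = u} {w} a<n hu hw asc le = ascent-⊑ {y = w} a<n (HasWord-σ a<n hu) hw asc
  λ k k≢a c → subst (_≤ R w k c) (sym (Sum-σ (ind c) a<n u k k≢a)) (le k c)

⊑-σ : ∀ {n a} {u w : SPerm n} → a < n → HasWord n u → HasWord n w → Ascent u a →
  u ⊑ w → u ⊑ compose w (σ n a)
⊑-σ {u = u} {w} a<n hu hw asc le = ascent-⊑ {x = u} a<n hu (HasWord-σ a<n hw) asc
  λ k k≢a c → subst (R u k c ≤_) (sym (Sum-σ (ind c) a<n w k k≢a)) (le k c)

R-idP : ∀ n a → R (idP n) a (+ a) ≡ 0
R-idP n a = go a ℕP.≤-refl
  where
  go : ∀ k → a ≤ k → R (idP n) k (+ a) ≡ 0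
  go = downward (λ k → a ≤ k → R (idP n) k (+ a) ≡ 0)
    (λ k n≤k _ → Sum-out (ind (+ a)) (idP n) n≤k)
    (λ k k<n ih a≤k → trans (R-uncounted (idP n) k<n (subst (+ a ℤ.<_) (sym (nth-tabulate (λ b → + suc b) k k<n)) (ℤ.+<+ (s≤s a≤k))))
      (ih (ℕP.m≤n⇒m≤1+n a≤k)))

-- A descent of u at a gives u s = id by induction. Then u(a+1) = `lo a` ≤ a is counted in row a at
-- threshold a, where the identity counts nothing.
⊑id⇒≡id : ∀ {n u} → 1 ≤ n → HasWord n u → u ⊑ idP n → u ≡ idP n
⊑id⇒≡id {n} 1≤n (k , U) le = go (<-wellFounded k) U le
  where
  go : ∀ {u k} → Acc _<_ k → Word n u k → u ⊑ idP n → u ≡ idP n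
  go {u} (acc rec) U le with descent? u
  ... | inj₂ asc = ascending⇒id 1≤n U asc
  ... | inj₁ (a , a<n , d) with exchange-σ a<n U d
  ...   | k' , k'<k , X = ⊥-elim (ℕP.<⇒≱ (ℕP.≤-trans (s≤s z≤n) (ℕP.≤-reflexive (sym (R-counted u a<n u≤a))))
            (ℕP.≤-trans (le a (+ a)) (ℕP.≤-reflexive (R-idP n a))))
    where
    x = compose u (σ n a)
    x≡id : x ≡ idP n
    x≡id = go (rec k'<k) X (σ-⊑ {u = u} a<n (_ , U) (_ , nil)
      (subst₂ ℤ._≤_ (sym (app-σ-lo a<n u)) (sym (app-σ-hi a<n u)) (ℤP.<⇒≤ d)) le)
    lo≤a : ∀ a → lo a ℤ.≤ + a
    lo≤a zero = ℤ.-≤+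
    lo≤a (suc a) = ℤP.≤-refl
    u≤a : nth u a ℤ.≤ + a
    u≤a = ℤP.≤-trans (ℤP.≤-reflexive (trans (sym (app-σ-lo a<n u)) (trans (cong (λ z → app z (lo a)) x≡id)
      (app-idP (lo a) (InR.upper (lo-InR a<n)))))) (lo≤a a)

⊑⇒chain : ∀ {n u w} → 1 ≤ n → HasWord n u → HasWord n w → u ⊑ w → Star (Up n) u w
⊑⇒chain {n} 1≤n hu (k , W) le = go (<-wellFounded k) hu W le
  where
  go : ∀ {u w k} → Acc _<_ k → HasWord n u → Word n w k → u ⊑ w → Star (Up n) u w
  go {u} {w} (acc rec) hu W le with descent? w
  ... | inj₂ asc with ascending⇒id 1≤n W asc
  ...   | refl with ⊑id⇒≡id 1≤n hu le
  ...     | refl = ε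
  go {u} {w} (acc rec) hu W le | inj₁ (a , a<n , d) with exchange-σ a<n W d | app u (lo a) ℤP.≤? app u (hi a)
  ... | k' , k'<k , W' | yes asc = subst (Star (Up n) u) (act-involutive (lo-InR a<n) (hi-InR a<n) w)
        (go (rec k'<k) hu W' (⊑-σ {u = u} {w} a<n hu (_ , W) asc le) ◅◅ (Up-σ a<n (_ , W') lt ◅ ε))
    where lt = subst₂ ℤ._<_ (sym (app-σ-lo a<n w)) (sym (app-σ-hi a<n w)) d
  -- Here u descends at a as well, so the descent is removed on both sides and the chain found
  -- between the products is multiplied back.
  ... | k' , k'<k , W' | no ¬asc = subst₂ (Star (Up n)) (act-involutive (lo-InR a<n) (hi-InR a<n) u)
        (act-involutive (lo-InR a<n) (hi-InR a<n) w)
        (Up-lift a<n (_ , W') lt (go (rec k'<k) (HasWord-σ a<n hu) W' uσ⊑wσ))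
    where
    lt = subst₂ ℤ._<_ (sym (app-σ-lo a<n w)) (sym (app-σ-hi a<n w)) d
    asc : Ascent (compose u (σ n a)) a
    asc = subst₂ ℤ._≤_ (sym (app-σ-lo a<n u)) (sym (app-σ-hi a<n u)) (ℤP.<⇒≤ (ℤP.≰⇒> ¬asc))
    uσ⊑wσ : compose u (σ n a) ⊑ compose w (σ n a)
    uσ⊑wσ = ⊑-σ {u = compose u (σ n a)} {w} a<n (HasWord-σ a<n hu) (_ , W) asc (σ-⊑ {u = u} {w} a<n hu (_ , W) asc le)

⊑⇒Bruhat : ∀ {n u w} → 1 ≤ n → HasWord n u → HasWord n w → u ⊑ w → BruhatLe n u w
⊑⇒Bruhat 1≤n hu hw le = gmap (λ z → z) (Up⇒BStep 1≤n) (⊑⇒chain 1≤n hu hw le)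

-- Pairs of partners

dbl : ℕ → ℕ
dbl zero = 0
dbl (suc i) = suc (suc (dbl i))

odd : ℕ → Bool
odd zero = false
odd (suc k) = not (odd k)

odd-dbl : ∀ i → odd (dbl i) ≡ false
odd-dbl zero = refl
odd-dbl (suc i) rewrite odd-dbl i = refl

-- c is split when the threshold "≤ c" separates two partners a, a* (or -a, -a*).
split : ℤ → Bool
split (+ k) = odd k
split -[1+ k ] = odd k

split-suc : ∀ c → split c ≡ true → split (ℤ.suc c) ≡ false
split-suc (+ k) e rewrite e = refl
split-suc -[1+ suc k ] e with odd k
... | false = refl

split-pred : ∀ c → split c ≡ true → split (ℤ.pred c) ≡ false
split-pred (+ suc k) e with odd k
... | false = refl
split-pred -[1+ k ] e rewrite e = refl

unsplit≢split : ∀ {c d} → split c ≡ false → split d ≡ true → c ≢ d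
unsplit≢split p q refl with () ← trans (sym p) q

data Pair (x y : ℤ) : Set where
  ascending  : split x ≡ true → y ≡ ℤ.suc x → Pair x y
  descending : split y ≡ true → x ≡ ℤ.suc y → Pair x y

Pair-unique : ∀ {x y z} → Pair x y → Pair z y → x ≡ z
Pair-unique {x} {_} {z} (ascending p refl) (ascending q e) = suc-inj e
  where
  suc-inj : ∀ {a b} → ℤ.suc a ≡ ℤ.suc b → a ≡ b
  suc-inj {a} {b} e = trans (sym (ℤP.pred-suc a)) (trans (cong ℤ.pred e) (ℤP.pred-suc b))
Pair-unique {x} (ascending p refl) (descending q refl) = contradiction refl (unsplit≢split {ℤ.suc x} (split-suc x p) q)
Pair-unique {z = z} (descending p refl) (ascending q refl) = contradiction refl (unsplit≢split {ℤ.suc z} (split-suc z q) p)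
Pair-unique (descending p refl) (descending q refl) = refl

-- The bound `top` is there for tails that contain n: they look like lists of pairs only at
-- thresholds below n. The mean clause is strict because it reads f at `suc c`.
record Balanced (top : ℤ) (f : ℤ → ℕ) : Set where
  field
    even : ∀ {c} → c ℤ.≤ top → split c ≡ false → ∃ λ h → f c ≡ h ℕ.+ h
    mean : ∀ {c} → c ℤ.< top → split c ≡ true → f c ℕ.+ f c ≡ f (ℤ.pred c) ℕ.+ f (ℤ.suc c)

Balanced-+ : ∀ {top f g} → Balanced top f → Balanced top g → Balanced top (λ c → f c ℕ.+ g c)
Balanced-+ {top} {f} {g} F G = record
  { even = λ c≤ s → let h , p = Balanced.even F c≤ s ; k , q = Balanced.even G c≤ s in
      h ℕ.+ k , trans (cong₂ ℕ._+_ p q) (interchange h h k k)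
  ; mean = λ {c} c< s → trans (interchange (f c) (g c) (f c) (g c))
      (trans (cong₂ ℕ._+_ (Balanced.mean F c< s) (Balanced.mean G c< s)) (interchange (f (ℤ.pred c)) _ (g (ℤ.pred c)) _)) }

Balanced-cong : ∀ {top f g} → (∀ c → f c ≡ g c) → Balanced top f → Balanced top g
Balanced-cong e F = record
  { even = λ {c} c≤ s → let h , p = Balanced.even F c≤ s in h , trans (sym (e c)) p
  ; mean = λ {c} c< s → trans (sym (cong₂ ℕ._+_ (e c) (e c))) (trans (Balanced.mean F c< s) (cong₂ ℕ._+_ (e _) (e _))) }

Balanced-zero : ∀ {top f} → (∀ {c} → c ℤ.≤ top → f c ≡ 0) → Balanced top f
Balanced-zero z = record
  { even = λ c≤ _ → 0 , z c≤
  ; mean = λ c< _ → trans (cong₂ ℕ._+_ (z (ℤP.<⇒≤ c<)) (z (ℤP.<⇒≤ c<)))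
      (sym (cong₂ ℕ._+_ (z (ℤP.i≤j⇒pred[i]≤j (ℤP.<⇒≤ c<))) (z (ℤP.i<j⇒suc[i]≤j c<)))) }

module _ {l : ℤ} (s : split l ≡ true) where
  private
    F : ℤ → ℕ
    F c = ind c l ℕ.+ ind c (ℤ.suc l)
    F-below : ∀ {c} → c ℤ.< l → F c ≡ 0
    F-below c<l = cong₂ ℕ._+_ (ind-> c<l) (ind-> (ℤP.<-trans c<l i<suc[i]))
    F-at : F l ≡ 1
    F-at = cong₂ ℕ._+_ (ind-≤ {l} ℤP.≤-refl) (ind-> {l} i<suc[i])
    F-above : ∀ {c} → l ℤ.< c → F c ≡ 2
    F-above l<c = cong₂ ℕ._+_ (ind-≤ (ℤP.<⇒≤ l<c)) (ind-≤ (ℤP.i<j⇒suc[i]≤j l<c))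
    F-even : ∀ {c} → split c ≡ false → ∃ λ h → F c ≡ h ℕ.+ h
    F-even {c} u with ℤP.<-cmp c l
    ... | tri< c<l _ _ = 0 , F-below c<l
    ... | tri≈ _ e _ = contradiction e (unsplit≢split u s)
    ... | tri> _ _ l<c = 1 , F-above l<c
    F-mean : ∀ {c} → split c ≡ true → F c ℕ.+ F c ≡ F (ℤ.pred c) ℕ.+ F (ℤ.suc c)
    F-mean {c} t with ℤP.<-cmp c l
    ... | tri< c<l _ _ = trans (cong₂ ℕ._+_ (F-below c<l) (F-below c<l)) (sym (cong₂ ℕ._+_
          (F-below (ℤP.≤-<-trans (ℤP.i≤j⇒pred[i]≤j (ℤP.≤-refl {c})) c<l))
          (F-below (ℤP.≤∧≢⇒< (ℤP.i<j⇒suc[i]≤j c<l) (unsplit≢split (split-suc c t) s)))))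
    ... | tri≈ _ refl _ = trans (cong₂ ℕ._+_ F-at F-at) (sym (cong₂ ℕ._+_
          (F-below (ℤP.i≤pred[j]⇒i<j {j = l} ℤP.≤-refl)) (F-above i<suc[i])))
    ... | tri> _ _ l<c = trans (cong₂ ℕ._+_ (F-above l<c) (F-above l<c)) (sym (cong₂ ℕ._+_
          (F-above (ℤP.≤∧≢⇒< (ℤP.i<j⇒i≤pred[j] l<c) (unsplit≢split (split-pred c t) s ∘ sym)))
          (F-above (ℤP.<-trans l<c i<suc[i]))))

  Balanced-block : ∀ {top} → Balanced top (λ c → ind c l ℕ.+ ind c (ℤ.suc l))
  Balanced-block = record { even = λ _ → F-even ; mean = λ _ → F-mean }

Balanced-pair : ∀ {top x y} → Pair x y → Balanced top (λ c → ind c x ℕ.+ ind c y)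
Balanced-pair {x = x} (ascending s refl) = Balanced-block {x} s
Balanced-pair {x = x} {y} (descending s refl) = Balanced-cong (λ c → ℕP.+-comm (ind c y) (ind c x)) (Balanced-block {y} s)

-- Doubling makes a slack of one worthless. It serves both for even counts and for halving an
-- inequality between means.
h+h≤k+k⇒h≤k : ∀ {h k} → h ℕ.+ h ≤ suc (k ℕ.+ k) → h ≤ k
h+h≤k+k⇒h≤k {h} {k} le with h ℕP.≤? k
... | yes h≤k = h≤k
... | no h≰k = ⊥-elim (ℕP.<⇒≱ (s≤s (ℕP.≤-reflexive (sym (ℕP.+-suc k k))))
      (ℕP.≤-trans (ℕP.+-mono-≤ (ℕP.≰⇒> h≰k) (ℕP.≰⇒> h≰k)) le))

-- Both functions are even at unsplit thresholds, so a deficit of one is impossible there,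
-- and a split threshold takes the mean of its two unsplit neighbours.
balanced-gain : ∀ {top f g} → split top ≡ false → Balanced top f → Balanced top g →
  (∀ {c} → c ℤ.≤ top → f c ≤ suc (g c)) → ∀ {c} → c ℤ.≤ top → f c ≤ g c
balanced-gain {top} {f} {g} st F G le = go
  where
  unsplit : ∀ {c} → c ℤ.≤ top → split c ≡ false → f c ≤ g c
  unsplit {c} c≤ s with Balanced.even F c≤ s | Balanced.even G c≤ s
  ... | h , p | k , q = subst₂ _≤_ (sym p) (sym q) (ℕP.+-mono-≤ h≤k h≤k)
    where h≤k = h+h≤k+k⇒h≤k {h} {k} (subst₂ (λ a b → a ≤ suc b) p q (le c≤))
  go : ∀ {c} → c ℤ.≤ top → f c ≤ g c
  go {c} c≤ with split c in s
  ... | false = unsplit c≤ s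
  ... | true = h+h≤k+k⇒h≤k (ℕP.m≤n⇒m≤1+n (subst₂ _≤_ (sym (Balanced.mean F c< s)) (sym (Balanced.mean G c< s))
          (ℕP.+-mono-≤ (unsplit (ℤP.i≤j⇒pred[i]≤j c≤) (split-pred c s)) (unsplit (ℤP.i<j⇒suc[i]≤j c<) (split-suc c s)))))
    where c< = ℤP.≤∧≢⇒< c≤ (unsplit≢split st s ∘ sym)

-- One-line notations as sequences of blocks

data Paired : ∀ {k} → Vec ℤ k → Set where
  []   : Paired []
  pair : ∀ {k x y} {xs : Vec ℤ k} → Pair x y → Paired xs → Paired (x ∷ y ∷ xs)

-- The index counts the pairs before N, so N has 0-based position 2r and n has position ±(2r+1).
data Blocks (N : ℤ) : ∀ {k} → Vec ℤ k → ℕ → Set where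
  here  : ∀ {k} {xs : Vec ℤ k} → Paired xs → Blocks N (N ∷ xs) 0
  there : ∀ {k x y r} {xs : Vec ℤ k} → Pair x y → Blocks N xs r → Blocks N (x ∷ y ∷ xs) (suc r)

Paired-balanced : ∀ {top k} {w : Vec ℤ k} → Paired w → ∀ i → Balanced top (R w (dbl i))
Paired-balanced [] i = Balanced-zero (λ _ → refl)
Paired-balanced (pair {x = x} {y} p P) zero =
  Balanced-cong (λ c → ℕP.+-assoc (ind c x) (ind c y) _) (Balanced-+ (Balanced-pair p) (Paired-balanced P zero))
Paired-balanced (pair p P) (suc i) = Paired-balanced P i

-- The tail still contains N, but N exceeds every threshold up to `top` and adds nothing.
Blocks-balanced-even : ∀ {top N k r} {w : Vec ℤ k} → Blocks N w r → top ℤ.< N → ∀ i → i ≤ r → Balanced top (R w (dbl i))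
Blocks-balanced-even (here P) top<N zero _ =
  Balanced-+ (Balanced-zero (λ c≤ → ind-> (ℤP.≤-<-trans c≤ top<N))) (Paired-balanced P 0)
Blocks-balanced-even (there {x = x} {y} p B) top<N zero _ =
  Balanced-cong (λ c → ℕP.+-assoc (ind c x) (ind c y) _) (Balanced-+ (Balanced-pair p) (Blocks-balanced-even B top<N zero z≤n))
Blocks-balanced-even (there p B) top<N (suc i) (s≤s i≤r) = Blocks-balanced-even B top<N i i≤r

-- The tail starts behind N and consists of whole pairs, for either sign of N.
Blocks-balanced-odd : ∀ {top N k r} {w : Vec ℤ k} → Blocks N w r → ∀ i → r ≤ i → Balanced top (R w (suc (dbl i)))
Blocks-balanced-odd (here P) i _ = Paired-balanced P i
Blocks-balanced-odd (there p B) (suc i) (s≤s r≤i) = Blocks-balanced-odd B i r≤i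

Blocks-special : ∀ {N k r} {w : Vec ℤ k} → Blocks N w r → nth w (dbl r) ≡ N × dbl r < k
Blocks-special (here P) = refl , s≤s z≤n
Blocks-special (there p B) = let e , l = Blocks-special B in e , s≤s (s≤s l)

Blocks-before : ∀ {N k r} {w : Vec ℤ k} → Blocks N w (suc r) → Pair (nth w (dbl r)) (nth w (suc (dbl r)))
Blocks-before {r = zero} (there p B) = p
Blocks-before {r = suc r} (there p B) = Blocks-before B

Blocks-after : ∀ {N k r} {w : Vec ℤ k} → Blocks N w r → suc (dbl r) < k →
  Pair (nth w (suc (dbl r))) (nth w (suc (suc (dbl r)))) × suc (suc (dbl r)) < k
Blocks-after (here []) (s≤s ())
Blocks-after (here (pair p P)) _ = p , s≤s (s≤s (s≤s z≤n))
Blocks-after (there p B) (s≤s (s≤s l)) = let q , l' = Blocks-after B l in q , s≤s (s≤s l')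

Adjacent : ℕ → ℕ → Set
Adjacent k l = l ≡ suc k ⊎ k ≡ suc l

-- A local form of the block structure that survives removing blocks from the front. Distinct
-- absolute values ensure that a removed entry is not the partner of a remaining one.
Linked : ℕ → ∀ {n} → Vec ℤ n → Set
Linked N {n} w = (∀ k → k < n → ∣ nth w k ∣ ≢ N →
    ∃ λ l → l < n × Adjacent k l × ∣ nth w l ∣ ≢ N × Pair (nth w k) (nth w l))
  × (∀ k l → k < n → l < n → ∣ nth w k ∣ ≡ ∣ nth w l ∣ → k ≡ l)

Linked-tail : ∀ {N n x} {xs : Vec ℤ n} → ∣ x ∣ ≡ N → Linked N (x ∷ xs) → Linked N xs
Linked-tail {N} {n} {x} {xs} x≡N (link , inj) = link' , λ k l k< l< e → ℕP.suc-injective (inj (suc k) (suc l) (s≤s k<) (s≤s l<) e)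
  where
  link' : ∀ k → k < n → ∣ nth xs k ∣ ≢ N → ∃ λ l → l < n × Adjacent k l × ∣ nth xs l ∣ ≢ N × Pair (nth xs k) (nth xs l)
  link' k k< ne with link (suc k) (s≤s k<) ne
  ... | zero , _ , _ , x≢N , _ = contradiction x≡N x≢N
  ... | suc l , s≤s l< , inj₁ e , ne' , p = l , l< , inj₁ (ℕP.suc-injective e) , ne' , p
  ... | suc l , s≤s l< , inj₂ e , ne' , p = l , l< , inj₂ (ℕP.suc-injective e) , ne' , p

Linked-tail² : ∀ {N n x y} {xs : Vec ℤ n} → Pair x y → Linked N (x ∷ y ∷ xs) → Linked N xs
Linked-tail² {N} {n} {x} {y} {xs} pxy (link , inj) = link' ,
  λ k l k< l< e → ℕP.suc-injective (ℕP.suc-injective (inj (suc (suc k)) (suc (suc l)) (s≤s (s≤s k<)) (s≤s (s≤s l<)) e))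
  where
  link' : ∀ k → k < n → ∣ nth xs k ∣ ≢ N → ∃ λ l → l < n × Adjacent k l × ∣ nth xs l ∣ ≢ N × Pair (nth xs k) (nth xs l)
  link' k k< ne with link (suc (suc k)) (s≤s (s≤s k<)) ne
  ... | suc (suc l) , s≤s (s≤s l<) , inj₁ e , ne' , p = l , l< , inj₁ (ℕP.suc-injective (ℕP.suc-injective e)) , ne' , p
  ... | suc (suc l) , s≤s (s≤s l<) , inj₂ e , ne' , p = l , l< , inj₂ (ℕP.suc-injective (ℕP.suc-injective e)) , ne' , p
  -- A later entry linked to y would equal x, the unique partner of y.
  ... | suc zero , _ , _ , _ , p with () ← inj 0 (suc (suc k)) (s≤s z≤n) (s≤s (s≤s k<)) (cong ∣_∣ (Pair-unique pxy p))
  ... | zero , _ , inj₁ () , _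
  ... | zero , _ , inj₂ () , _

first-pair : ∀ {N n x} {xs : Vec ℤ n} → Linked N (x ∷ xs) → ∣ x ∣ ≢ N → 1 ≤ n × ∣ nth xs 0 ∣ ≢ N × Pair x (nth xs 0)
first-pair (link , _) x≢N with link 0 (s≤s z≤n) x≢N
... | _ , s≤s l< , inj₁ refl , ne , p = l< , ne , p

Linked⇒Paired : ∀ {N n} (xs : Vec ℤ n) → Linked N xs → (∀ k → k < n → ∣ nth xs k ∣ ≢ N) → Paired xs
Linked⇒Paired [] L ne = []
Linked⇒Paired (x ∷ xs) L ne with first-pair L (ne 0 (s≤s z≤n))
Linked⇒Paired (x ∷ y ∷ xs) L ne | _ , _ , p = pair p (Linked⇒Paired xs (Linked-tail² p L) (λ k k< → ne (suc (suc k)) (s≤s (s≤s k<))))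

Linked⇒Blocks : ∀ {N n} (xs : Vec ℤ n) → Linked N xs → ∀ k → k < n → ∣ nth xs k ∣ ≡ N →
  ∃ λ M → ∣ M ∣ ≡ N × ∃ λ r → Blocks M xs r
Linked⇒Blocks {N} (x ∷ xs) L k k< e with ∣ x ∣ ℕP.≟ N
... | yes x≡N = x , x≡N , 0 , here (Linked⇒Paired xs (Linked-tail x≡N L)
      λ l l< e' → contradiction (proj₂ L 0 (suc l) (s≤s z≤n) (s≤s l<) (trans x≡N (sym e'))) λ ())
... | no x≢N with first-pair L x≢N
Linked⇒Blocks (x ∷ y ∷ xs) L 0 k< e | no x≢N | _ , y≢N , p = contradiction e x≢N
Linked⇒Blocks (x ∷ y ∷ xs) L 1 k< e | no x≢N | _ , y≢N , p = contradiction e y≢N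
Linked⇒Blocks (x ∷ y ∷ xs) L (suc (suc k)) (s≤s (s≤s k<)) e | no x≢N | _ , y≢N , p =
  let M , m , r , B = Linked⇒Blocks xs (Linked-tail² p L) k k< e in M , m , suc r , there p B

-- From conditions on positions to blocks

posFrom : ℤ → ∀ {k} → Vec ℤ k → ℕ → ℤ
posFrom a [] i = + 0
posFrom a (x ∷ xs) i =
  if does (x ℤP.≟ a) then + i else
  if does (x ℤP.≟ - a) then - (+ i) else posFrom a xs (suc i)

-- The recursion equations determine the function, and the local search inside `pos` satisfies them
-- by `refl`.
posFrom-unique : (a : ℤ) (G : ∀ {k} → Vec ℤ k → ℕ → ℤ) →
  (∀ i → G [] i ≡ + 0) →
  (∀ {k} x (xs : Vec ℤ k) i → G (x ∷ xs) i ≡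
    (if does (x ℤP.≟ a) then + i else if does (x ℤP.≟ - a) then - (+ i) else G xs (suc i))) →
  ∀ {k} (xs : Vec ℤ k) i → G xs i ≡ posFrom a xs i
posFrom-unique a G nl cn [] i = nl i
posFrom-unique a G nl cn (x ∷ xs) i rewrite cn x xs i with x ℤP.≟ a | x ℤP.≟ - a
... | yes _ | _ = refl
... | no _ | yes _ = refl
... | no _ | no _ = posFrom-unique a G nl cn xs (suc i)

-- posGo is the local function go of pos; it has no name outside Defs, but unification finds it.
mutual
  posGo : ∀ {n} → SPerm n → ℤ → ∀ {k} → Vec ℤ k → ℕ → ℤ
  posGo = _

  pos≡posFrom : ∀ {n} (w : SPerm n) a → pos w a ≡ posFrom a w 1
  pos≡posFrom [] a = refl
  pos≡posFrom {suc n} (x ∷ xs) a with x ℤP.≟ a | x ℤP.≟ - a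
  ... | yes _ | _ = refl
  ... | no _ | yes _ = refl
  -- Length, vector and start index become variables, so that `posGo` is applied to distinct
  -- variables and unification has a unique solution.
  ... | no _ | no _ with suc n | x ∷ xs | 2
  ... | N | w | i = trans (unfold w i) (posFrom-unique a (posGo w a) (λ _ → refl) (λ _ _ _ → refl) xs i)
    where
    unfold : ∀ w i → _ ≡ posGo w a xs i
    unfold w i = refl

posFrom-skip : ∀ a x {k} (xs : Vec ℤ k) i → ∣ x ∣ ≢ ∣ a ∣ → posFrom a (x ∷ xs) i ≡ posFrom a xs (suc i)
posFrom-skip a x xs i ne
  rewrite dec-false (x ℤP.≟ a) (ne ∘ cong ∣_∣)
        | dec-false (x ℤP.≟ - a) (λ e → ne (trans (cong ∣_∣ e) (ℤP.∣-i∣≡∣i∣ a))) = refl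

posFrom-reach : ∀ a {k} (xs : Vec ℤ k) i p → p < k → (∀ l → l < p → ∣ nth xs l ∣ ≢ ∣ a ∣) →
  (nth xs p ≡ a → posFrom a xs i ≡ + (p ℕ.+ i)) × (NZ a → nth xs p ≡ - a → posFrom a xs i ≡ - (+ (p ℕ.+ i)))
posFrom-reach a (x ∷ xs) i zero _ _ = plus , minus
  where
  plus : x ≡ a → posFrom a (x ∷ xs) i ≡ + i
  plus e rewrite dec-true (x ℤP.≟ a) e = refl
  minus : NZ a → x ≡ - a → posFrom a (x ∷ xs) i ≡ - (+ i)
  minus nz e rewrite dec-false (x ℤP.≟ a) (λ e' → x≢-x nz (trans (sym e') e)) | dec-true (x ℤP.≟ - a) e = refl
posFrom-reach a (x ∷ xs) i (suc p) (s≤s p<k) away =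
  (λ e → trans skip (trans (proj₁ rest e) (cong +_ (ℕP.+-suc p i)))) ,
  (λ nz e → trans skip (trans (proj₂ rest nz e) (cong (λ z → - (+ z)) (ℕP.+-suc p i))))
  where
  skip = posFrom-skip a x xs i (away 0 (s≤s z≤n))
  rest = posFrom-reach a xs (suc i) p p<k (λ l l<p → away (suc l) (s≤s l<p))

module _ {n} {w : SPerm n} (V : Valid n w) {k} (k<n : k < n) where
  private
    away : ∀ {a} → ∣ nth w k ∣ ≡ a → ∀ l → l < k → ∣ nth w l ∣ ≢ a
    away e l l<k e' = ℕP.<⇒≢ l<k (nth-∣∣-injective {w = w} V (ℕP.<-trans l<k k<n) k<n (trans e' (sym e)))

  pos-plus : ∀ {a} → nth w k ≡ + suc a → pos w (+ suc a) ≡ + suc k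
  pos-plus {a} e = trans (pos≡posFrom w (+ suc a)) (trans
    (proj₁ (posFrom-reach (+ suc a) w 1 k k<n (away (cong ∣_∣ e))) e) (cong +_ (ℕP.+-comm k 1)))

  pos-minus : ∀ {a} → nth w k ≡ -[1+ a ] → pos w (+ suc a) ≡ -[1+ k ]
  pos-minus {a} e = trans (pos≡posFrom w (+ suc a)) (trans
    (proj₂ (posFrom-reach (+ suc a) w 1 k k<n (away (cong ∣_∣ e))) (λ ()) e) (cong (λ z → - (+ z)) (ℕP.+-comm k 1)))

∣⊖∣≤1⇒Adjacent : ∀ k l → ∣ k ⊖ l ∣ ≤ 1 → k ≢ l → Adjacent k l
∣⊖∣≤1⇒Adjacent zero zero h ne = contradiction refl ne
∣⊖∣≤1⇒Adjacent zero (suc zero) h ne = inj₁ refl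
∣⊖∣≤1⇒Adjacent zero (suc (suc l)) (s≤s ()) ne
∣⊖∣≤1⇒Adjacent (suc zero) zero h ne = inj₂ refl
∣⊖∣≤1⇒Adjacent (suc (suc k)) zero (s≤s ()) ne
∣⊖∣≤1⇒Adjacent (suc k) (suc l) h ne
  with ∣⊖∣≤1⇒Adjacent k l (subst (λ z → ∣ z ∣ ≤ 1) (ℤP.[1+m]⊖[1+n]≡m⊖n k l) h) (ne ∘ cong suc)
... | inj₁ e = inj₁ (cong suc e)
... | inj₂ e = inj₂ (cong suc e)

Adjacent-suc⁻¹ : ∀ {k l} → Adjacent (suc k) (suc l) → Adjacent k l
Adjacent-suc⁻¹ (inj₁ e) = inj₁ (ℕP.suc-injective e)
Adjacent-suc⁻¹ (inj₂ e) = inj₂ (ℕP.suc-injective e)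

Adjacent-sym : ∀ {k l} → Adjacent k l → Adjacent l k
Adjacent-sym (inj₁ e) = inj₂ e
Adjacent-sym (inj₂ e) = inj₁ e

-- Positions of opposite sign differ by at least 2, so close positions carry entries of equal sign.
close-positions : ∀ {n} {w : SPerm n} → Valid n w → ∀ {k a b} → k < n → ∣ nth w k ∣ ≡ suc a → b < n → a ≢ b →
  ∣ pos w (+ suc a) ℤ.- pos w (+ suc b) ∣ ≤ 1 →
  ∃ λ l → l < n × Adjacent k l ×
    (nth w k ≡ + suc a × nth w l ≡ + suc b ⊎ nth w k ≡ -[1+ a ] × nth w l ≡ -[1+ b ])
close-positions {n} {w} V {k} {a} {b} k<n ka b<n a≢b close with nth-surjective {w = w} V (s≤s z≤n) b<n
... | l , l<n , lb = l , l<n , go (∣∣-cases (nth w k) (+ suc a) ka) (∣∣-cases (nth w l) (+ suc b) lb)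
  where
  k≢l : suc k ≢ suc l
  k≢l refl = a≢b (ℕP.suc-injective (trans (sym ka) lb))
  go : nth w k ≡ + suc a ⊎ nth w k ≡ -[1+ a ] → nth w l ≡ + suc b ⊎ nth w l ≡ -[1+ b ] →
    Adjacent k l × (nth w k ≡ + suc a × nth w l ≡ + suc b ⊎ nth w k ≡ -[1+ a ] × nth w l ≡ -[1+ b ])
  go (inj₁ p) (inj₁ q) = Adjacent-suc⁻¹ (∣⊖∣≤1⇒Adjacent (suc k) (suc l)
      (subst₂ (λ x y → ∣ x ℤ.- y ∣ ≤ 1) (pos-plus {w = w} V k<n p) (pos-plus {w = w} V l<n q) close) k≢l) , inj₁ (p , q)
  go (inj₂ p) (inj₂ q) = Adjacent-suc⁻¹ (Adjacent-sym (∣⊖∣≤1⇒Adjacent (suc l) (suc k)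
      (subst₂ (λ x y → ∣ x ℤ.- y ∣ ≤ 1) (pos-minus {w = w} V k<n p) (pos-minus {w = w} V l<n q) close) (k≢l ∘ sym))) , inj₂ (p , q)
  go (inj₁ p) (inj₂ q) with subst₂ (λ x y → ∣ x ℤ.- y ∣ ≤ 1) (pos-plus {w = w} V k<n p) (pos-minus {w = w} V l<n q) close
  ... | s≤s h = contradiction h (ℕP.<⇒≱ (ℕP.≤-trans (s≤s z≤n) (ℕP.m≤n+m (suc l) k)))
  go (inj₂ p) (inj₁ q) with subst₂ (λ x y → ∣ x ℤ.- y ∣ ≤ 1) (pos-minus {w = w} V k<n p) (pos-plus {w = w} V l<n q) close
  ... | s≤s ()

dbl≡*2 : ∀ i → dbl i ≡ i ℕ.* 2
dbl≡*2 zero = refl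
dbl≡*2 (suc i) = cong (suc ∘ suc) (dbl≡*2 i)

dbl-mono-< : ∀ {i j} → i < j → dbl i < dbl j
dbl-mono-< {zero} {suc j} _ = s≤s z≤n
dbl-mono-< {suc i} {suc j} (s≤s h) = s≤s (s≤s (dbl-mono-< h))

dbl-mono-≤ : ∀ {i j} → i ≤ j → dbl i ≤ dbl j
dbl-mono-≤ z≤n = z≤n
dbl-mono-≤ (s≤s h) = s≤s (s≤s (dbl-mono-≤ h))

dbl-cancel-< : ∀ {i j} → dbl i < dbl j → i < j
dbl-cancel-< {i} {j} h = ℕP.≰⇒> λ j≤i → ℕP.<⇒≱ h (dbl-mono-≤ j≤i)

halve : ∀ a → ∃ λ i → a ≡ dbl i ⊎ a ≡ suc (dbl i)
halve zero = 0 , inj₁ refl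
halve (suc zero) = 0 , inj₂ refl
halve (suc (suc a)) with halve a
... | i , inj₁ e = suc i , inj₁ (cong (suc ∘ suc) e)
... | i , inj₂ e = suc i , inj₂ (cong (suc ∘ suc) e)

star-odd : ∀ {n} i → suc (suc (dbl i)) ≤ n → star n (suc (dbl i)) ≡ suc (suc (dbl i))
star-odd {n} i h rewrite dbl≡*2 i | DM.[m+kn]%n≡m%n 1 i 2 ⦃ _ ⦄
  | dec-true (suc (suc (i ℕ.* 2)) ℕP.≤? n) h = refl

star-even : ∀ n i → star n (suc (suc (dbl i))) ≡ suc (dbl i)
star-even n i rewrite dbl≡*2 i | DM.m*n%n≡0 (suc i) 2 ⦃ _ ⦄ = refl

InW⇒Linked : ∀ m {w : SPerm (suc (dbl m))} → InW (suc (dbl m)) w → Linked (suc (dbl m)) w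
InW⇒Linked m {w} (V , W) = link , λ k l k< l< → nth-∣∣-injective {w = w} V k< l<
  where
  n = suc (dbl m)
  odd-split : ∀ i → split (+ suc (dbl i)) ≡ true
  odd-split i = cong not (odd-dbl i)
  link : ∀ k → k < n → ∣ nth w k ∣ ≢ n → ∃ λ l → l < n × Adjacent k l × ∣ nth w l ∣ ≢ n × Pair (nth w k) (nth w l)
  link k k<n ne with ∣ nth w k ∣ in ka | nth-InR {w = w} V k<n
  ... | zero | inR l _ = contradiction l (ℕP.<⇒≱ (s≤s (ℕP.≤-reflexive ka)))
  ... | suc a | r = go (halve a)
    where
    a<n : suc a < n
    a<n = ℕP.≤∧≢⇒< (subst (_≤ n) ka (InR.upper r)) ne
    go : (∃ λ i → a ≡ dbl i ⊎ a ≡ suc (dbl i)) → ∃ λ l → l < n × Adjacent k l × ∣ nth w l ∣ ≢ n × Pair (nth w k) (nth w l)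
    go (i , inj₁ refl) = mate (close-positions {w = w} V k<n ka b<n (ℕP.<⇒≢ ℕP.≤-refl)
        (subst (λ z → ∣ pos w (+ suc (dbl i)) ℤ.- pos w (+ z) ∣ ≤ 1) (star-odd i b<n) (W (suc (dbl i)) (s≤s z≤n) a<n)))
      where
      -- An odd value below the odd number n leaves room for its even partner, which is again below
      -- n.
      b<m : suc (suc (dbl i)) ≤ dbl m
      b<m = dbl-mono-≤ (dbl-cancel-< {i} {m} (ℕP.≤-pred a<n))
      b<n : suc (suc (dbl i)) ≤ n
      b<n = ℕP.m≤n⇒m≤1+n b<m
      mate : _ → _
      mate (l , l<n , adj , inj₁ (p , q)) = l , l<n , adj , (λ e → ℕP.<⇒≢ (s≤s b<m) (trans (sym (cong ∣_∣ q)) e)) ,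
        ascending (trans (cong split p) (odd-split i)) (trans q (cong ℤ.suc (sym p)))
      mate (l , l<n , adj , inj₂ (p , q)) = l , l<n , adj , (λ e → ℕP.<⇒≢ (s≤s b<m) (trans (sym (cong ∣_∣ q)) e)) ,
        descending (trans (cong split q) (odd-split i)) (trans p (cong ℤ.suc (sym q)))
    go (i , inj₂ refl) = mate (close-positions {w = w} V k<n ka b<n (ℕP.>⇒≢ ℕP.≤-refl)
        (subst (λ z → ∣ pos w (+ suc (suc (dbl i))) ℤ.- pos w (+ z) ∣ ≤ 1) (star-even n i) (W (suc (suc (dbl i))) (s≤s z≤n) a<n)))
      where
      b<n : suc (dbl i) ≤ n
      b<n = ℕP.≤-trans (ℕP.n≤1+n _) (ℕP.<⇒≤ a<n)
      mate : _ → _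
      mate (l , l<n , adj , inj₁ (p , q)) = l , l<n , adj , (λ e → ℕP.<⇒≢ (ℕP.<-trans ℕP.≤-refl a<n) (trans (sym (cong ∣_∣ q)) e)) ,
        descending (trans (cong split q) (odd-split i)) (trans p (cong ℤ.suc (sym q)))
      mate (l , l<n , adj , inj₂ (p , q)) = l , l<n , adj , (λ e → ℕP.<⇒≢ (ℕP.<-trans ℕP.≤-refl a<n) (trans (sym (cong ∣_∣ q)) e)) ,
        ascending (trans (cong split p) (odd-split i)) (trans q (cong ℤ.suc (sym p)))

InW⇒Blocks : ∀ m {w : SPerm (suc (dbl m))} → InW (suc (dbl m)) w →
  (∃ λ r → Blocks (+ suc (dbl m)) w r × pos w (+ suc (dbl m)) ≡ + suc (dbl r)) ⊎
  (∃ λ r → Blocks -[1+ dbl m ] w r × pos w (+ suc (dbl m)) ≡ -[1+ dbl r ])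
InW⇒Blocks m {w} I@(V , _) with nth-surjective {w = w} V (s≤s z≤n) ℕP.≤-refl
... | k , k<n , e with Linked⇒Blocks w (InW⇒Linked m {w} I) k k<n e
... | M , M≡ , r , B with ∣∣-cases M (+ suc (dbl m)) M≡
... | inj₁ refl = inj₁ (r , B , pos-plus {w = w} V (proj₂ (Blocks-special B)) (proj₁ (Blocks-special B)))
... | inj₂ refl = inj₂ (r , B , pos-minus {w = w} V (proj₂ (Blocks-special B)) (proj₁ (Blocks-special B)))

-- The map c

∣x∣≤n⇒x≤n : ∀ {n} x → ∣ x ∣ ≤ n → x ℤ.≤ + n
∣x∣≤n⇒x≤n (+ k) h = ℤ.+≤+ h
∣x∣≤n⇒x≤n -[1+ k ] h = ℤ.-≤+

∣x∣≤n⇒-n≤x : ∀ {n} x → ∣ x ∣ ≤ suc n → -[1+ n ] ℤ.≤ x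
∣x∣≤n⇒-n≤x (+ k) h = ℤ.-≤+
∣x∣≤n⇒-n≤x -[1+ k ] (s≤s h) = ℤ.-≤- h

∣nth∣≤n : ∀ {n} (w : SPerm n) → Valid n w → ∀ k → ∣ nth w k ∣ ≤ n
∣nth∣≤n {n} w V k with k ℕP.<? n
... | yes k<n = InR.upper (nth-InR {w = w} V k<n)
... | no k≮n = ℕP.≤-trans (ℕP.≤-reflexive (cong ∣_∣ (nth-out w k (ℕP.≮⇒≥ k≮n)))) z≤n

app≤n : ∀ {n} (w : SPerm n) → Valid n w → ∀ x → app w x ℤ.≤ + n
app≤n w V (+ 0) = ℤ.+≤+ z≤n
app≤n w V (+ suc k) = ∣x∣≤n⇒x≤n _ (∣nth∣≤n w V k)
app≤n {n} w V -[1+ k ] = ∣x∣≤n⇒x≤n _ (subst (_≤ n) (sym (ℤP.∣-i∣≡∣i∣ (nth w k))) (∣nth∣≤n w V k))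

R-full : ∀ {n} (u w : SPerm n) {c} → (∀ l → nth w l ℤ.≤ c) → ∀ k → R u k c ≤ R w k c
R-full u w {c} h k = Sum-mono u w k λ l _ → ℕP.≤-trans (ind≤1 c (nth u l)) (ℕP.≤-reflexive (sym (ind-≤ (h l))))

-- Each step carries words for its two ends, and u ≢ v rules out the empty chain.
Bruhat⇒words : ∀ {n u v} → BruhatLe n u v → u ≢ v → HasWord n u × HasWord n v
Bruhat⇒words ε ne = contradiction refl ne
Bruhat⇒words {n} (s@(_ , _ , _ , _ , _ , (U , _) , (W , _) , _) ◅ chain) _ = (_ , U) , last chain (_ , W)
  where
  last : ∀ {x y} → BruhatLe n x y → HasWord n x → HasWord n y
  last ε hx = hx
  last ((_ , _ , _ , _ , _ , _ , (W , _) , _) ◅ c) hx = last c (_ , W)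

module Descend {n} (1≤n : 1 ≤ n) {u v : SPerm n} (V : Valid n v)
  (hu : HasWord n u) (hv : HasWord n v) (u⊑v : u ⊑ v) where

  -- The swap changes only rows p < k ≤ q, and thresholds from n on count every entry of v'; `mid`
  -- is what remains. The inversion in v lets exchange supply a word for v'.
  below-swap : ∀ {p q} → p < q → q < n → nth v q ℤ.< nth v p → let v' = compose v (transp n (+ suc p) (+ suc q)) in
    (Swapped v v' p q → ∀ k → p < k → k ≤ q → ∀ {c} → c ℤ.< + n → R u k c ≤ R v' k c) → BruhatLe n u v'
  below-swap {p} {q} p<q q<n desc mid = ⊑⇒Bruhat 1≤n hu (proj₁ X , proj₂ (proj₂ X)) go
    where
    v' = compose v (transp n (+ suc p) (+ suc q))
    ri : InR n (+ suc p)
    ri = inR (s≤s z≤n) (ℕP.<-trans p<q q<n)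
    rj : InR n (+ suc q)
    rj = inR (s≤s z≤n) q<n
    X = exchange (proj₂ hv) ri rj (ℤ.+<+ (s≤s p<q)) desc
    S = act-Swapped v p<q q<n
    go : u ⊑ v'
    go k c with c ℤP.<? + n
    ... | no c≮n = R-full u v' (λ l → ℤP.≤-trans (ℤP.≤-reflexive (app-act ri rj v (+ suc l)))
          (ℤP.≤-trans (app≤n v V (swapZ (+ suc p) (+ suc q) (+ suc l))) (ℤP.≮⇒≥ c≮n))) k
    ... | yes c<n with k ℕP.≤? p | k ℕP.≤? q
    ...   | yes k≤p | _ = ℕP.≤-trans (u⊑v k c) (ℕP.≤-reflexive (sym (Sum-swap-below S (ind c) k k≤p)))
    ...   | no _ | no k≰q = ℕP.≤-trans (u⊑v k c) (ℕP.≤-reflexive (sym (Sum-swap-above S (ind c) (ℕP.≰⇒> k≰q))))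
    ...   | no k≰p | yes k≤q = mid S k (ℕP.≰⇒> k≰p) k≤q c<n

  below-σ₀ : Descent v 0 → (∀ {c} → c ℤ.< + n → R u 0 c ≤ R v 1 c) → BruhatLe n u (compose v (σ n 0))
  below-σ₀ desc row = ⊑⇒Bruhat 1≤n hu (HasWord-σ 1≤n hv) go
    where
    v' = compose v (σ n 0)
    go : u ⊑ v'
    go (suc k) c = ℕP.≤-trans (u⊑v (suc k) c) (ℕP.≤-reflexive (sym (Sum-σ (ind c) 1≤n v (suc k) (λ ()))))
    go zero c with c ℤP.<? + n
    ... | no c≮n = R-full u v' (λ l → ℤP.≤-trans (ℤP.≤-reflexive (app-act (lo-InR 1≤n) (hi-InR 1≤n) v (+ suc l)))
          (ℤP.≤-trans (app≤n v V (sw 0 (+ suc l))) (ℤP.≮⇒≥ c≮n))) 0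
    ... | yes c<n = ℕP.≤-trans (row c<n) (ℕP.≤-trans (ℕP.≤-reflexive (sym (Sum-σ (ind c) 1≤n v 1 (λ ())))) (R-suc≤ v' 0 c))

between₁ : ∀ {p k} → p < k → k ≤ suc p → k ≡ suc p
between₁ p<k k≤ = ℕP.≤-antisym k≤ p<k

between₂ : ∀ {p k} → p < k → k ≤ suc (suc p) → k ≡ suc p ⊎ k ≡ suc (suc p)
between₂ {p} {k} p<k k≤ with k ℕP.≤? suc p
... | yes k≤' = inj₁ (ℕP.≤-antisym k≤' p<k)
... | no k≰ = inj₂ (ℕP.≤-antisym k≤ (ℕP.≰⇒> k≰))

R≤-cons : ∀ {n} {w : SPerm n} {k c a b} → k < n → a ≤ ind c (nth w k) → b ≤ R w (suc k) c → a ℕ.+ b ≤ R w k c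
R≤-cons {w = w} {k} {c} k<n ha hb = ℕP.≤-trans (ℕP.+-mono-≤ ha hb) (ℕP.≤-reflexive (sym (Sum-step (ind c) w k<n)))

module Cases (m : ℕ) where
  n = suc (dbl m)
  1≤n : 1 ≤ n
  1≤n = s≤s z≤n

  top : ∀ {c} → c ℤ.< + n → c ℤ.≤ + dbl m
  top = i<suc[j]⇒i≤j

  top<n : + dbl m ℤ.< + n
  top<n = ℤ.+<+ ℕP.≤-refl

  module _ {u v : SPerm n} (V : Valid n v) (hu : HasWord n u) (hv : HasWord n v) (u⊑v : u ⊑ v) where
    open Descend 1≤n V hu hv u⊑v

    -- Turning the leading -n into n costs row 0 at most one count. Row 0 of u without n and row 1
    -- of v are both balanced, so parity restores it.
    first : ∀ {p} → Blocks (+ n) u p → Blocks -[1+ dbl m ] v 0 → BruhatLe n u (compose v (σ n 0))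
    first Bu Bv = below-σ₀ desc (λ c<n → balanced-gain (odd-dbl m) (Blocks-balanced-even Bu top<n 0 z≤n)
        (Blocks-balanced-odd Bv 0 z≤n) (λ {c} _ → ℕP.≤-trans (u⊑v 0 c) (R≤suc v 1≤n c)) (top c<n))
      where
      desc : Descent v 0
      desc = subst (λ z → z ℤ.< - z) (sym (proj₁ (Blocks-special Bv))) ℤ.-<+

    module Positive {p q} (Bu : Blocks (+ n) u p) (Bv : Blocks (+ n) v q) (q<p : q < p) where
      e = dbl q
      e+2<n : suc (suc e) < n
      e+2<n = ℕP.≤-<-trans (dbl-mono-≤ q<p) (proj₂ (Blocks-special Bu))
      e+1<n = ℕP.<-trans ℕP.≤-refl e+2<n
      a = nth v (suc e)
      b = nth v (suc (suc e))

      -- In u the entry n comes later and is invisible below n; in v the tail starts behind n and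
      -- one further pair. The deficit of one to be excluded is the entry b between the two rows of
      -- v.
      gain : ∀ {c} → c ℤ.< + n → R u (suc (suc e)) c ≤ R v (suc (suc (suc e))) c
      gain c<n = balanced-gain (odd-dbl m) (Blocks-balanced-even Bu top<n (suc q) q<p) (Blocks-balanced-odd Bv (suc q) (ℕP.n≤1+n q))
        (λ {c} _ → ℕP.≤-trans (u⊑v (suc (suc e)) c) (R≤suc v e+2<n c)) (top c<n)

      descending-case : b ℤ.< a → BruhatLe n u (compose v (transp n (+ suc (suc e)) (+ suc (suc (suc e)))))
      descending-case b<a = below-swap ℕP.≤-refl e+2<n b<a go
        where
        v' = compose v (transp n (+ suc (suc e)) (+ suc (suc (suc e))))
        go : Swapped v v' (suc e) (suc (suc e)) → ∀ k → suc e < k → k ≤ suc (suc e) → ∀ {c} → c ℤ.< + n → R u k c ≤ R v' k c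
        go S k l h {c} c<n with between₁ l h
        ... | refl = ℕP.≤-trans (gain c<n) (ℕP.≤-trans (ℕP.≤-reflexive (sym (Sum-swap-above S (ind c) ℕP.≤-refl))) (R-suc≤ v' k c))

      ascending-case : a ℤ.< b → BruhatLe n u (compose v (transp n (+ suc e) (+ suc (suc (suc e)))))
      ascending-case a<b = below-swap (ℕP.m<n⇒m<1+n ℕP.≤-refl) e+2<n b<n go
        where
        v' = compose v (transp n (+ suc e) (+ suc (suc (suc e))))
        b<n : nth v (suc (suc e)) ℤ.< nth v e
        b<n = subst (b ℤ.<_) (sym (proj₁ (Blocks-special Bv))) (ℤP.≤∧≢⇒< (app≤n v V (+ suc (suc (suc e))))
          λ eq → contradiction
            (nth-∣∣-injective {w = v} V e+2<n (proj₂ (Blocks-special Bv)) (cong ∣_∣ (trans eq (sym (proj₁ (Blocks-special Bv))))))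
            (ℕP.>⇒≢ (ℕP.m<n⇒m<1+n ℕP.≤-refl)))
        go : Swapped v v' e (suc (suc e)) → ∀ k → e < k → k ≤ suc (suc e) → ∀ {c} → c ℤ.< + n → R u k c ≤ R v' k c
        go S k l h {c} c<n with between₂ l h
        ... | inj₂ refl = row₂
          where
          row₂ : R u (suc (suc e)) c ≤ R v' (suc (suc e)) c
          row₂ = ℕP.≤-trans (gain c<n) (ℕP.≤-trans (ℕP.≤-reflexive (sym (Sum-swap-above S (ind c) ℕP.≤-refl))) (R-suc≤ v' k c))
        -- If a ≤ c, the entry a, which stays in place, pays for the additional row. Otherwise a and
        -- b both exceed c, and rows e+1 and e+3 of v agree.
        ... | inj₁ refl with a ℤP.≤? c
        ...   | yes a≤c = begin
          R u (suc e) c                  ≤⟨ R≤suc u e+1<n c ⟩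
          suc (R u (suc (suc e)) c)      ≤⟨ s≤s (gain c<n) ⟩
          suc (R v (suc (suc (suc e))) c) ≡⟨ cong suc (Sum-swap-above S (ind c) ℕP.≤-refl) ⟨
          suc (R v' (suc (suc (suc e))) c)
            ≤⟨ R≤-cons {w = v'} e+1<n (ℕP.≤-reflexive (sym (trans (cong (ind c) a-fixed) (ind-≤ a≤c)))) (R-suc≤ v' (suc (suc e)) c) ⟩
          R v' (suc e) c                 ∎
          where
          open ℕP.≤-Reasoning
          a-fixed : nth v' (suc e) ≡ a
          a-fixed = Swapped.elsewhere S (suc e) (ℕP.>⇒≢ ℕP.≤-refl) (ℕP.<⇒≢ ℕP.≤-refl)
        ...   | no a≰c = begin
          R u (suc e) c                  ≤⟨ u⊑v (suc e) c ⟩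
          R v (suc e) c                  ≡⟨ R-uncounted v e+1<n (ℤP.≰⇒> a≰c) ⟩
          R v (suc (suc e)) c            ≡⟨ R-uncounted v e+2<n (ℤP.<-trans (ℤP.≰⇒> a≰c) a<b) ⟩
          R v (suc (suc (suc e))) c      ≡⟨ Sum-swap-above S (ind c) ℕP.≤-refl ⟨
          R v' (suc (suc (suc e))) c     ≤⟨ R-suc≤ v' (suc (suc e)) c ⟩
          R v' (suc (suc e)) c           ≤⟨ R-suc≤ v' (suc e) c ⟩
          R v' (suc e) c                 ∎
          where open ℕP.≤-Reasoning

    -- Each alternative for u provides a balanced row: row d+1 if it starts behind the special
    -- entry, and row d below threshold n if n comes later. A later -n in u would contradict the
    -- order of the positions of n.
    module Negative {p q} (Bv : Blocks -[1+ dbl m ] v (suc q))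
      (Bu : (∃ λ N → Blocks N u p × p ≤ q) ⊎ (Blocks (+ n) u p × suc q ≤ p)) where
      d = dbl q
      d+2<n : suc (suc d) < n
      d+2<n = proj₂ (Blocks-special Bv)
      d+1<n : suc d < n
      d+1<n = ℕP.<-trans ℕP.≤-refl d+2<n
      d<n : d < n
      d<n = ℕP.<-trans ℕP.≤-refl d+1<n
      y = nth v d
      x = nth v (suc d)
      Q = R v (suc (suc (suc d)))
      v-n : nth v (suc (suc d)) ≡ -[1+ dbl m ]
      v-n = proj₁ (Blocks-special Bv)

      Q-balanced : ∀ {t} → Balanced t Q
      Q-balanced = Blocks-balanced-odd Bv (suc q) ℕP.≤-refl

      R-x : ∀ c → R v (suc d) c ≡ ind c x ℕ.+ R v (suc (suc d)) c
      R-x c = Sum-step (ind c) v d+1<n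

      -- In use, l is the smaller of the partners x and y, so both orders of the pair share these
      -- estimates.
      module _ {l : ℤ} (l-split : split l ≡ true) (l≤x : l ℤ.≤ x) (l≤y : l ℤ.≤ y) (pair-yx : Pair y x) where

        unpaired : ∀ {c} → c ℤ.< l → R v (suc d) c ≤ suc (Q c)
        unpaired {c} c<l = ℕP.≤-trans (ℕP.≤-reflexive (R-uncounted v d+1<n (ℤP.<-≤-trans c<l l≤x))) (R≤suc v d+2<n c)

        removed : ∀ {c} → Blocks (+ n) u p → suc q ≤ p → c ℤ.< + n → R u d c ≤ ind c y ℕ.+ ind c x ℕ.+ Q c
        removed B q<p c<n = balanced-gain (odd-dbl m) (Blocks-balanced-even B top<n q (ℕP.<⇒≤ q<p))
          (Balanced-+ (Balanced-pair pair-yx) Q-balanced)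
          (λ {c} _ → ℕP.≤-trans (u⊑v d c) (step c)) (top c<n)
          where
          step : ∀ c → R v d c ≤ suc (ind c y ℕ.+ ind c x ℕ.+ Q c)
          step c = begin
            R v d c                                         ≡⟨ Sum-step (ind c) v d<n ⟩
            ind c y ℕ.+ R v (suc d) c                       ≡⟨ cong (ind c y ℕ.+_) (R-x c) ⟩
            ind c y ℕ.+ (ind c x ℕ.+ R v (suc (suc d)) c)   ≡⟨ ℕP.+-assoc (ind c y) _ _ ⟨
            ind c y ℕ.+ ind c x ℕ.+ R v (suc (suc d)) c     ≤⟨ ℕP.+-monoʳ-≤ (ind c y ℕ.+ ind c x) (R≤suc v d+2<n c) ⟩
            ind c y ℕ.+ ind c x ℕ.+ suc (Q c)               ≡⟨ ℕP.+-suc (ind c y ℕ.+ ind c x) (Q c) ⟩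
            suc (ind c y ℕ.+ ind c x ℕ.+ Q c)               ∎
            where open ℕP.≤-Reasoning

        -- Below l neither x nor y is counted, so rows d and d+1 of v exceed `Q` by the contribution
        -- of -n at most, which parity removes.
        gain-below : ∀ {c} → c ℤ.< l → R u (suc d) c ≤ Q c
        gain-below {c} c<l = go Bu
          where
          go : _ → R u (suc d) c ≤ Q c
          go (inj₁ (_ , B , p≤q)) = balanced-gain (split-pred l l-split) (Blocks-balanced-odd B q p≤q) Q-balanced
            (λ {c} c≤ → ℕP.≤-trans (u⊑v (suc d) c) (unpaired (ℤP.i≤pred[j]⇒i<j c≤))) (ℤP.i<j⇒i≤pred[j] c<l)
          go (inj₂ (B , q<p)) = ℕP.≤-trans (R-suc≤ u d c)
            (ℕP.≤-trans (removed B q<p (ℤP.<-≤-trans c<l (ℤP.≤-trans l≤x (app≤n v V (+ suc (suc d))))))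
              (ℕP.≤-reflexive (cong (ℕ._+ Q c) (cong₂ ℕ._+_ (ind-> (ℤP.<-≤-trans c<l l≤y)) (ind-> (ℤP.<-≤-trans c<l l≤x))))))

        -- Parity says nothing at the split threshold l itself. If row d+1 of u is balanced, the
        -- excess over `Q` is at most 0 at l-1 and 2 at l+1, hence at most 1 at l; otherwise row d
        -- gives the bound, counting x but not y.
        gain-at : x ≡ l → y ≡ ℤ.suc l → R u (suc d) l ≤ suc (Q l)
        gain-at x≡l y≡ = go Bu
          where
          l<y : l ℤ.< y
          l<y = j≡suc[i]⇒i<j l y≡
          go : _ → R u (suc d) l ≤ suc (Q l)
          go (inj₁ (_ , B , p≤q)) = h+h≤k+k⇒h≤k (ℕP.m≤n⇒m≤1+n (begin
            R u (suc d) l ℕ.+ R u (suc d) l       ≡⟨ Balanced.mean (Blocks-balanced-odd {ℤ.suc l} B q p≤q) i<suc[i] l-split ⟩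
            R u (suc d) (ℤ.pred l) ℕ.+ R u (suc d) (ℤ.suc l)
              ≤⟨ ℕP.+-mono-≤ (gain-below (ℤP.i≤pred[j]⇒i<j {j = l} ℤP.≤-refl))
                   (ℕP.≤-trans (u⊑v (suc d) (ℤ.suc l)) (ℕP.≤-trans (R≤suc v d+1<n (ℤ.suc l)) (s≤s (R≤suc v d+2<n (ℤ.suc l))))) ⟩
            Q (ℤ.pred l) ℕ.+ suc (suc (Q (ℤ.suc l)))   ≡⟨ trans (ℕP.+-suc (Q (ℤ.pred l)) _) (cong suc (ℕP.+-suc (Q (ℤ.pred l)) _)) ⟩
            suc (suc (Q (ℤ.pred l) ℕ.+ Q (ℤ.suc l)))   ≡⟨ cong (suc ∘ suc) (Balanced.mean (Q-balanced {ℤ.suc l}) i<suc[i] l-split) ⟨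
            suc (suc (Q l ℕ.+ Q l))                    ≡⟨ cong suc (ℕP.+-suc (Q l) (Q l)) ⟨
            suc (Q l) ℕ.+ suc (Q l)                    ∎))
            where open ℕP.≤-Reasoning
          go (inj₂ (B , q<p)) = ℕP.≤-trans (R-suc≤ u d l) (ℕP.≤-trans (removed B q<p (ℤP.<-≤-trans l<y (app≤n v V (+ suc d))))
            (ℕP.≤-reflexive (cong (ℕ._+ Q l) (cong₂ ℕ._+_ (ind-> l<y) (ind-≤ (ℤP.≤-reflexive x≡l))))))

      descending-case : split x ≡ true → y ≡ ℤ.suc x → BruhatLe n u (compose v (transp n (+ suc d) (+ suc (suc d))))
      descending-case s y≡ = below-swap ℕP.≤-refl d+1<n x<y go
        where
        x<y : x ℤ.< y
        x<y = j≡suc[i]⇒i<j x y≡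
        v' = compose v (transp n (+ suc d) (+ suc (suc d)))
        row : ∀ c → R u (suc d) c ≤ ind c y ℕ.+ R v (suc (suc d)) c
        row c with ℤP.<-cmp c x
        ... | tri< c<x _ _ = ℕP.≤-trans (gain-below s ℤP.≤-refl (ℤP.<⇒≤ x<y) (descending s y≡) c<x)
              (ℕP.≤-trans (R-suc≤ v (suc (suc d)) c) (ℕP.m≤n+m _ _))
        -- Only at c = x does exchanging y and x lose a count. There -n is counted, so row d+2 of v
        -- is one more than `Q`.
        ... | tri≈ _ refl _ = ℕP.≤-trans (gain-at s ℤP.≤-refl (ℤP.<⇒≤ x<y) (descending s y≡) refl y≡)
              (ℕP.≤-trans (ℕP.≤-reflexive (sym (R-counted v d+2<n (subst (ℤ._≤ x) (sym v-n) (∣x∣≤n⇒-n≤x x (∣nth∣≤n v V (suc d)))))))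
                (ℕP.m≤n+m _ _))
        ... | tri> _ _ x<c = ℕP.≤-trans (u⊑v (suc d) c) (ℕP.≤-trans (R≤suc v d+1<n c)
              (ℕP.≤-reflexive (cong (ℕ._+ R v (suc (suc d)) c) (sym (ind-≤ (ℤP.≤-trans (ℤP.≤-reflexive y≡) (ℤP.i<j⇒suc[i]≤j x<c)))))))
        go : Swapped v v' d (suc d) → ∀ k → d < k → k ≤ suc d → ∀ {c} → c ℤ.< + n → R u k c ≤ R v' k c
        go S k l h {c} c<n with between₁ l h
        ... | refl = ℕP.≤-trans (row c) (R≤-cons {w = v'} d+1<n
              (ℕP.≤-reflexive (cong (ind c) (sym (Swapped.at-q S)))) (ℕP.≤-reflexive (sym (Sum-swap-above S (ind c) ℕP.≤-refl))))

      ascending-case : split y ≡ true → x ≡ ℤ.suc y → BruhatLe n u (compose v (transp n (+ suc d) (+ suc (suc (suc d)))))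
      ascending-case s x≡ = below-swap (ℕP.m<n⇒m<1+n ℕP.≤-refl) d+2<n -n<y go
        where
        y<x : y ℤ.< x
        y<x = j≡suc[i]⇒i<j y x≡
        v' = compose v (transp n (+ suc d) (+ suc (suc (suc d))))
        -n<y : nth v (suc (suc d)) ℤ.< y
        -n<y = ℤP.≤∧≢⇒< (subst (ℤ._≤ y) (sym v-n) (∣x∣≤n⇒-n≤x y (∣nth∣≤n v V d)))
          λ eq → contradiction (nth-∣∣-injective {w = v} V d+2<n d<n (cong ∣_∣ eq)) (ℕP.>⇒≢ (ℕP.m<n⇒m<1+n ℕP.≤-refl))
        -- With y in the place of -n, rows d+1 and d+2 can lose a count only at thresholds below y,
        -- the smaller partner.
        below : ∀ {c} → c ℤ.< y → R u (suc d) c ≤ Q c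
        below = gain-below s (ℤP.<⇒≤ y<x) ℤP.≤-refl (ascending s x≡)
        row₂ : ∀ c → R u (suc (suc d)) c ≤ ind c y ℕ.+ Q c
        row₂ c with y ℤP.≤? c
        ... | yes y≤c = ℕP.≤-trans (u⊑v (suc (suc d)) c) (R≤suc v d+2<n c)
        ... | no y≰c = ℕP.≤-trans (R-suc≤ u (suc d) c) (below (ℤP.≰⇒> y≰c))
        row₁ : ∀ c → R u (suc d) c ≤ ind c x ℕ.+ (ind c y ℕ.+ Q c)
        row₁ c with y ℤP.≤? c
        ... | yes y≤c = ℕP.≤-trans (u⊑v (suc d) c) (ℕP.≤-trans (ℕP.≤-reflexive (R-x c)) (ℕP.+-monoʳ-≤ (ind c x) (R≤suc v d+2<n c)))
        ... | no y≰c = ℕP.≤-trans (below (ℤP.≰⇒> y≰c)) (ℕP.m≤n+m _ _)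
        module _ (S : Swapped v v' d (suc (suc d))) where
          row₂≤ : ∀ c → ind c y ℕ.+ Q c ≤ R v' (suc (suc d)) c
          row₂≤ c = R≤-cons {w = v'} d+2<n (ℕP.≤-reflexive (cong (ind c) (sym (Swapped.at-q S))))
            (ℕP.≤-reflexive (sym (Sum-swap-above S (ind c) ℕP.≤-refl)))
          row₁≤ : ∀ c → ind c x ℕ.+ (ind c y ℕ.+ Q c) ≤ R v' (suc d) c
          row₁≤ c = R≤-cons {w = v'} d+1<n
            (ℕP.≤-reflexive (cong (ind c) (sym (Swapped.elsewhere S (suc d) (ℕP.>⇒≢ ℕP.≤-refl) (ℕP.<⇒≢ ℕP.≤-refl)))))
            (row₂≤ c)
        go : Swapped v v' d (suc (suc d)) → ∀ k → d < k → k ≤ suc (suc d) → ∀ {c} → c ℤ.< + n → R u k c ≤ R v' k c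
        go S k l h {c} c<n with between₂ l h
        ... | inj₂ refl = ℕP.≤-trans (row₂ c) (row₂≤ S c)
        ... | inj₁ refl = ℕP.≤-trans (row₁ c) (row₁≤ S c)

-- Evaluation of `cmap` and the final case distinction

cmap-neg-one : ∀ {n} (v : SPerm n) → pos v (+ n) ≡ -[1+ 0 ] → cmap n v ≡ compose v (transp n (+ 1) (- (+ 1)))
cmap-neg-one v e rewrite e = refl

module _ {n} (v : SPerm n) {j} (pos-n : pos v (+ n) ≡ j) (j≢-1 : j ≢ - (+ 1)) where
  cmap-desc : app v (j ℤ.+ + 2) ℤ.< app v (j ℤ.+ + 1) → cmap n v ≡ compose v (transp n (j ℤ.+ + 1) (j ℤ.+ + 2))
  cmap-desc lt rewrite pos-n | dec-false (j ℤP.≟ - (+ 1)) j≢-1 | dec-true (app v (j ℤ.+ + 2) ℤP.<? app v (j ℤ.+ + 1)) lt = refl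

  cmap-asc : ¬ app v (j ℤ.+ + 2) ℤ.< app v (j ℤ.+ + 1) → cmap n v ≡ compose v (transp n j (j ℤ.+ + 2))
  cmap-asc ge rewrite pos-n | dec-false (j ℤP.≟ - (+ 1)) j≢-1 | dec-false (app v (j ℤ.+ + 2) ℤP.<? app v (j ℤ.+ + 1)) ge = refl

module _ {n} (v : SPerm n) {e} (pos-n : pos v (+ n) ≡ + suc e) where
  private
    j+1 : + suc e ℤ.+ + 1 ≡ + suc (suc e)
    j+1 = cong +_ (ℕP.+-comm (suc e) 1)
    j+2 : + suc e ℤ.+ + 2 ≡ + suc (suc (suc e))
    j+2 = cong +_ (ℕP.+-comm (suc e) 2)

  cmap-plus-desc : nth v (suc (suc e)) ℤ.< nth v (suc e) → cmap n v ≡ compose v (transp n (+ suc (suc e)) (+ suc (suc (suc e))))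
  cmap-plus-desc lt = trans (cmap-desc v pos-n (λ ()) (subst₂ (λ a b → app v a ℤ.< app v b) (sym j+2) (sym j+1) lt))
    (cong₂ (λ a b → compose v (transp n a b)) j+1 j+2)

  cmap-plus-asc : nth v (suc e) ℤ.< nth v (suc (suc e)) → cmap n v ≡ compose v (transp n (+ suc e) (+ suc (suc (suc e))))
  cmap-plus-asc lt = trans (cmap-asc v pos-n (λ ()) (λ gt → ℤP.<-asym lt (subst₂ (λ a b → app v a ℤ.< app v b) j+2 j+1 gt)))
    (cong (λ b → compose v (transp n (+ suc e) b)) j+2)

module _ {n} (v : SPerm n) {d} (pos-n : pos v (+ n) ≡ -[1+ suc (suc d) ]) where
  -- For j = -(d+3) the test compares -v(d+2) with -v(d+1), so it is reversed in terms of the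
  -- entries; the transposition is rewritten with positive positions.
  cmap-minus-desc : nth v (suc d) ℤ.< nth v d → cmap n v ≡ compose v (transp n (+ suc d) (+ suc (suc d)))
  cmap-minus-desc lt = trans (cmap-desc v pos-n (λ ()) (ℤP.neg-mono-< lt))
    (cong (compose v) (transp-flip {i = + suc d} {+ suc (suc d)} (λ ()) (λ ())))

  cmap-minus-asc : nth v d ℤ.< nth v (suc d) → cmap n v ≡ compose v (transp n (+ suc d) (+ suc (suc (suc d))))
  cmap-minus-asc lt = trans (cmap-asc v pos-n (λ ()) (λ gt → ℤP.<-asym lt (ℤP.neg-cancel-< gt)))
    (cong (compose v) (transp-flip {i = + suc d} {+ suc (suc (suc d))} (λ ()) (λ ())))

-- The size n is a variable with an equation, so that matching on `refl` replaces `2 * m + 1` by the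
-- form `suc (dbl m)` on which the block lemmas compute.
below-cmap : ∀ m {n} → n ≡ suc (dbl m) → (u v : SPerm n) → InW n u → InW n v → BruhatLt n u v →
  pos v (+ n) ℤ.< pos u (+ n) → BruhatLe n u (cmap n v)
below-cmap m refl u v Iu Iv@(V , _) (u≤v , u≢v) j<j' with Bruhat⇒words u≤v u≢v
... | hu , hv = go (InW⇒Blocks m {u} Iu) (InW⇒Blocks m {v} Iv)
  where
  n = suc (dbl m)
  u⊑v : u ⊑ v
  u⊑v = Bruhat⇒⊑ (s≤s z≤n) u≤v
  transport : ∀ {w} → cmap n v ≡ w → BruhatLe n u w → BruhatLe n u (cmap n v)
  transport e = subst (BruhatLe n u) (sym e)
  order : ∀ {a b} → pos u (+ n) ≡ a → pos v (+ n) ≡ b → b ℤ.< a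
  order p q = subst₂ ℤ._<_ q p j<j'
  negative : ∀ {p q} → Blocks -[1+ dbl m ] v (suc q) → pos v (+ n) ≡ -[1+ suc (suc (dbl q)) ] →
    (∃ λ N → Blocks N u p × p ≤ q) ⊎ (Blocks (+ n) u p × suc q ≤ p) → BruhatLe n u (cmap n v)
  negative {q = q} Bv pv Bu with Blocks-before Bv
  ... | descending s e = transport (cmap-minus-desc v pv (j≡suc[i]⇒i<j (nth v (suc (dbl q))) e))
        (Cases.Negative.descending-case m V hu hv u⊑v Bv Bu s e)
  ... | ascending s e = transport (cmap-minus-asc v pv (j≡suc[i]⇒i<j (nth v (dbl q)) e))
        (Cases.Negative.ascending-case m V hu hv u⊑v Bv Bu s e)

  go : (∃ λ r → Blocks (+ n) u r × pos u (+ n) ≡ + suc (dbl r)) ⊎ (∃ λ r → Blocks -[1+ dbl m ] u r × pos u (+ n) ≡ -[1+ dbl r ]) →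
    (∃ λ r → Blocks (+ n) v r × pos v (+ n) ≡ + suc (dbl r)) ⊎ (∃ λ r → Blocks -[1+ dbl m ] v r × pos v (+ n) ≡ -[1+ dbl r ]) →
    BruhatLe n u (cmap n v)
  go (inj₁ (p , Bu , pu)) (inj₁ (q , Bv , pv)) with order pu pv
  ... | ℤ.+<+ (s≤s q<p) with Blocks-after Bv (ℕP.<-trans ℕP.≤-refl (Cases.Positive.e+2<n m V hu hv u⊑v Bu Bv (dbl-cancel-< q<p)))
  ... | ascending _ e , _ = transport (cmap-plus-asc v pv a<b)
        (Cases.Positive.ascending-case m V hu hv u⊑v Bu Bv (dbl-cancel-< q<p) a<b)
    where a<b = j≡suc[i]⇒i<j (nth v (suc (dbl q))) e
  ... | descending _ e , _ = transport (cmap-plus-desc v pv b<a)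
        (Cases.Positive.descending-case m V hu hv u⊑v Bu Bv (dbl-cancel-< q<p) b<a)
    where b<a = j≡suc[i]⇒i<j (nth v (suc (suc (dbl q)))) e
  go (inj₂ (p , Bu , pu)) (inj₁ (q , Bv , pv)) with () ← order pu pv
  go (inj₁ (p , Bu , pu)) (inj₂ (zero , Bv , pv)) =
    transport (trans (cmap-neg-one v pv) (cong (compose v) (transp-comm {i = + 1} { -[1+ 0 ]} (λ ()) (λ ()))))
      (Cases.first m V hu hv u⊑v Bu Bv)
  go (inj₂ (p , Bu , pu)) (inj₂ (zero , Bv , pv)) with order pu pv
  ... | ℤ.-<- ()
  go (inj₂ (p , Bu , pu)) (inj₂ (suc q , Bv , pv)) with order pu pv
  ... | ℤ.-<- lt = negative Bv pv (inj₁ (_ , Bu , ℕP.≤-pred (dbl-cancel-< {p} {suc q} lt)))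
  go (inj₁ (p , Bu , pu)) (inj₂ (suc q , Bv , pv)) with p ℕP.≤? q
  ... | yes p≤q = negative Bv pv (inj₁ (_ , Bu , p≤q))
  ... | no p≰q = negative Bv pv (inj₂ (Bu , ℕP.≰⇒> p≰q))

theorem4p9 : (m : ℕ) → 1 ≤ m → (u v : SPerm (2 * m + 1))
    → InW (2 * m + 1) u → InW (2 * m + 1) v
    → BruhatLt (2 * m + 1) u v
    → pos v (+ (2 * m + 1)) ℤ.< pos u (+ (2 * m + 1))
    → BruhatLe (2 * m + 1) u (cmap (2 * m + 1) v)
theorem4p9 m _ = below-cmap m (trans (ℕP.+-comm (2 * m) 1) (cong suc (trans (ℕP.*-comm 2 m) (sym (dbl≡*2 m)))))
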